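{- Let $w = w(b_1,\dots,b_m)$ be a layered permutation in $S_n$ (so $b_1+\dots+b_m = n$). If $b_m\leq n/2$, then \[ |\mathrm{supp}(\mathfrak S_w)| \geq b_m!\cdot|\mathrm{supp}(\mathfrak S_{w'})|,\qquad\text{where } w' := w(b_1,\dots,b_{m-1})\in S_{n-b_m}. \]
   Context: Given positive integers $b_1,\dots,b_m$, set $c_i = b_1+\dots+b_i$ ($c_0=0$). The layered permutation $w(b_1,\dots,b_m)\in S_{c_m}$ has one-line notation $c_1\,(c_1-1)\cdots 1\; c_2\,(c_2-1)\cdots(c_1+1)\;\cdots\; c_m\,(c_m-1)\cdots(c_{m-1}+1)$. For $w\in S_n$, the Schubert polynomial $\mathfrak S_w(x_1,\dots,x_n)$ is defined by $\mathfrak S_{w_0} = x_1^{n-1}x_2^{n-2}\cdots x_{n-1}$ for the longest element $w_0$ and $\mathfrak S_w = \partial_i(\mathfrak S_{ws_i})$ when $\ell(w)<\ell(ws_i)$, where $\partial_i(f) = (f - s_if)/(x_i-x_{i+1})$ and $s_i$ swaps $x_i, x_{i+1}$. Its support $\mathrm{supp}(\mathfrak S_w)$ is the set of exponent vectors $\alpha\in\mathbb Z_{\geq0}^n$ of monomials $\mathbf x^\alpha$ with nonzero coefficient in $\mathfrak S_w$. -}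

module Defs where

open import Data.Nat using (ℕ; zero; suc; _+_; _*_; _∸_; _<ᵇ_; _≟_)
open import Data.Integer as ℤ using (ℤ; +_; -_)
open import Data.List using (List; []; _∷_; _++_; map; concatMap; foldr; filter; deduplicate; length; reverse; upTo; [_])
open import Data.List.Properties using (≡-dec)
open import Data.Product using (_×_; _,_; proj₁; proj₂)
open import Data.Maybe using (Maybe; just; nothing)
open import Data.Bool using (Bool; true; false; if_then_else_)
open import Relation.Nullary using (does; ¬?)
open import Relation.Binary.Definitions using (DecidableEquality)
import Data.Maybe

-- Conventions.
-- A permutation w ∈ S_n is given by its one-line notation, a list
-- [w(1), …, w(n)] of the values 1..n.  Positions are 0-indexed below:
-- position i of the list holds w(i+1).
-- An exponent vector α ∈ ℤ≥0^n is a List ℕ of length n.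
-- A polynomial in x_1..x_n with integer coefficients is a formal sum
-- of terms (α , c) meaning c·x^α (repeated exponents are allowed; the
-- actual coefficient of x^α is the sum of all c attached to α).

Exp : Set
Exp = List ℕ

Poly : Set
Poly = List (Exp × ℤ)

_≟ₑ_ : DecidableEquality Exp
_≟ₑ_ = ≡-dec _≟_

coeff : Poly → Exp → ℤ
coeff f γ = foldr (λ t acc → (if does (proj₁ t ≟ₑ γ) then proj₂ t else + 0) ℤ.+ acc) (+ 0) f

supp : Poly → List Exp
supp f = deduplicate _≟ₑ_ (filter (λ α → ¬? (coeff f α ℤ.≟ + 0)) (map proj₁ f))

at : List ℕ → ℕ → ℕ
at []       _       = 0
at (x ∷ xs) zero    = x
at (x ∷ xs) (suc i) = at xs i

set : List ℕ → ℕ → ℕ → List ℕ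
set []       _       _ = []
set (x ∷ xs) zero    v = v ∷ xs
set (x ∷ xs) (suc i) v = x ∷ set xs i v

swapAt : ℕ → List ℕ → List ℕ
swapAt i w = set (set w i (at w (suc i))) (suc i) (at w i)

-- Divided difference ∂_i (0-indexed variables x_i, x_{i+1}).
-- (f - s_i f)/(x_i - x_{i+1}) computed termwise: for a term c·x^α with
-- a = α_i, b = α_{i+1}:
--   a > b : c · Σ_{k=0}^{a-b-1} x_i^{b+k} x_{i+1}^{a-1-k} (other exps kept)
--   a < b : -c · Σ_{k=0}^{b-a-1} x_i^{a+k} x_{i+1}^{b-1-k}
--   a = b : 0
∂term : ℕ → Exp × ℤ → Poly
∂term i (α , c) =
  let a = at α i ; b = at α (suc i) in
  if b <ᵇ a
    then map (λ k → (set (set α i (b + k)) (suc i) (a ∸ 1 ∸ k) , c)) (upTo (a ∸ b))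
    else (if a <ᵇ b
      then map (λ k → (set (set α i (a + k)) (suc i) (b ∸ 1 ∸ k) , - c)) (upTo (b ∸ a))
      else [])

∂ : ℕ → Poly → Poly
∂ i f = concatMap (∂term i) f

firstAscent : List ℕ → Maybe ℕ
firstAscent []           = nothing
firstAscent (x ∷ [])     = nothing
firstAscent (x ∷ y ∷ ys) =
  if x <ᵇ y then just 0 else Data.Maybe.map suc (firstAscent (y ∷ ys))

nonInv : List ℕ → ℕ
nonInv []       = 0
nonInv (x ∷ xs) = length (filter (λ y → Data.Nat._<?_ x y) xs) + nonInv xs

schubW0 : ℕ → Poly
schubW0 n = [ (reverse (upTo n) , + 1) ]

-- S_w = ∂_i S_{w s_i} whenever ℓ(w) < ℓ(w s_i); we use the first ascent i.
-- The recursion runs exactly ℓ(w0) - ℓ(w) steps (fuel = nonInv w).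
schubAux : ℕ → ℕ → List ℕ → Poly
schubAux n zero    w = schubW0 n
schubAux n (suc k) w with firstAscent w
... | just i  = ∂ i (schubAux n k (swapAt i w))
... | nothing = []

schubert : List ℕ → Poly
schubert w = schubAux (length w) (nonInv w) w

layeredFrom : ℕ → List ℕ → List ℕ
layeredFrom c []       = []
layeredFrom c (b ∷ bs) = map (λ k → c + b ∸ k) (upTo b) ++ layeredFrom (c + b) bs

layered : List ℕ → List ℕ
layered bs = layeredFrom 0 bs

{-# OPTIONS --safe #-}

-- Write w = w′ ⊕ w₀(b) with w′ ∈ S_c. The divided differences leading from w to
-- w₀(c) ⊕ w₀(b) are those leading from w′ to w₀(c), and the Schubert polynomial of
-- w₀(c) ⊕ w₀(b) is x^(c-1,…,1,0) · Q with Q = ∑ s_μ(x₁,…,x_c) x^β, β being supported on the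
-- last b variables. As Q is symmetric in x₁,…,x_c, this gives 𝔖_w = 𝔖_w′ · Q, so that
-- 𝔖_w has nonnegative coefficients by induction. If b ≤ c, every β with
-- β_i ≤ b - i occurs in Q; picking a term x^σ x^β of Q for each of these b! vectors,
-- (α , β) ↦ (α + σ , β) is injective on supp 𝔖_w′ × {β} with values in supp 𝔖_w.
--
-- The expansion of Q rests on π_{c-1} ⋯ π_0 (x_0^k s_μ(x_1,…,x_c)) = s_(k,μ)(x_0,…,x_c) for the
-- isobaric divided differences π_i f = ∂_i (x_i f), where Schur polynomials are defined by
-- branching. Polynomials enter only through their pairings with functionals
-- φ : Exp → ℤ, on which ∂_i acts by its transpose δ i.
module Submission where

open import Defs
open import Data.Bool using (true; false; if_then_else_)
import Data.Integer as ℤ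
open import Data.Integer using (ℤ; 0ℤ; 1ℤ) renaming (_+_ to _+ᶻ_; _-_ to _-ᶻ_; _*_ to _*ᶻ_)
import Data.Integer.Properties as ℤₚ
open import Data.Integer.Tactic.RingSolver using (solve-∀)
open import Data.List using (List; []; _∷_; length; _++_; [_]; _∷ʳ_; map; concatMap; foldr; filter; reverse; replicate; zipWith; applyUpTo; upTo; downFrom; cartesianProduct; cartesianProductWith)
open import Data.List.Membership.Propositional using (_∈_; find; lose)
open import Data.List.Membership.Propositional.Properties
import Data.List.Membership.DecPropositional _≟ₑ_ as DecMem
open import Data.List.Properties using (++-assoc; ++-identityʳ; ∷-injective; ∷-injectiveˡ; ∷-injectiveʳ; filter-++; filter-all; filter-none; foldr-++; length-++; length-downFrom; length-map; length-replicate; length-upTo; map-cong; map-upTo; map-∘; reverse-upTo; upTo-∷ʳ)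
open import Data.List.Relation.Unary.All as All using (All; []; _∷_)
import Data.List.Relation.Unary.All.Properties as All
open import Data.List.Relation.Unary.AllPairs using (AllPairs; []; _∷_)
open import Data.List.Relation.Unary.Any using (here; there)
open import Data.List.Relation.Unary.Unique.DecPropositional.Properties _≟ₑ_ using (deduplicate-!)
open import Data.List.Relation.Unary.Unique.Propositional using (Unique)
open import Data.List.Relation.Unary.Unique.Propositional.Properties using (cartesianProduct⁺; cartesianProductWith⁺; upTo⁺)
open import Data.List.Reverse using (Reverse; reverseView; []; _∶_∶ʳ_)
import Data.Maybe as Maybe
open import Data.Maybe using (just)
open import Data.Nat using (ℕ; zero; suc; _≤_; _<_; _>_; _*_; _+_; _∸_; _⊓_; _⊔_; _!; _<ᵇ_; _≤?_; _<?_; z≤n; s≤s)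
open import Data.Nat.ListAction using (sum)
open import Data.Nat.ListAction.Properties using (sum-++)
open import Data.Nat.Properties hiding (_≤?_; _<?_)
import Data.Nat.Tactic.RingSolver as ℕ-Solver
open import Data.Product using (∃; _×_; _,_; proj₁; proj₂)
open import Data.Sum using (inj₁; inj₂)
open import Data.Unit using (⊤; tt)
open import Function using (_∘_)
open import Relation.Binary.Definitions using (tri<; tri≈; tri>)
open import Relation.Binary.PropositionalEquality hiding ([_]; J)
open import Relation.Nullary using (Dec; yes; no; does; contradiction; ¬_; ¬?)
open import Relation.Nullary.Decidable using (_×-dec_; dec-true; dec-false)
open ≡-Reasoning

-- A `Poly` is a formal sum whose terms may repeat and cancel, so an identity of polynomials is
-- stated as equality of all pairings `⟨ f , φ ⟩`. Coefficients are the pairings with `𝟙`, and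
-- symmetry in two neighbouring variables is the vanishing of the pairing with every `δ i φ`; no
-- quotient has to be formed.
--
-- The obstacle is that branching on the last variable hides the symmetry of Schur polynomials.
-- Symmetry is therefore proved together with the action of π on the last two variables: π acts as
-- expected because, by induction, a shorter Schur-like factor is symmetric and passes through it,
-- and the result is symmetric because ∂π = ∂∂x = 0.
--
-- The hypothesis b ≤ c enters at a single point. After k steps the partition μ has at most k
-- nonzero parts out of c, so for k < c its last part is 0. The part that branching forces into the
-- horizontal strip is then empty, and strips of all sizes 0, ..., k exist: k + 1 choices at each
-- step, b! altogether.

private variable
  A B : Set

-- Finite sums

∑ : List A → (A → ℤ) → ℤ
∑ []       f = 0ℤ
∑ (x ∷ xs) f = f x +ᶻ ∑ xs f

∑-cong-∈ : ∀ (xs : List A) {f g} → (∀ x → x ∈ xs → f x ≡ g x) → ∑ xs f ≡ ∑ xs g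
∑-cong-∈ []       f≗g = refl
∑-cong-∈ (x ∷ xs) f≗g = cong₂ _+ᶻ_ (f≗g x (here refl)) (∑-cong-∈ xs λ y y∈ → f≗g y (there y∈))

∑-cong : ∀ (xs : List A) {f g} → (∀ x → f x ≡ g x) → ∑ xs f ≡ ∑ xs g
∑-cong xs f≗g = ∑-cong-∈ xs λ x _ → f≗g x

∑-++ : ∀ (xs ys : List A) f → ∑ (xs ++ ys) f ≡ ∑ xs f +ᶻ ∑ ys f
∑-++ []       ys f = sym (ℤₚ.+-identityˡ _)
∑-++ (x ∷ xs) ys f = trans (cong (f x +ᶻ_) (∑-++ xs ys f)) (sym (ℤₚ.+-assoc (f x) _ _))

∑-map : ∀ (g : A → B) xs f → ∑ (map g xs) f ≡ ∑ xs (f ∘ g)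
∑-map g []       f = refl
∑-map g (x ∷ xs) f = cong (f (g x) +ᶻ_) (∑-map g xs f)

∑-concatMap : ∀ (g : A → List B) xs f → ∑ (concatMap g xs) f ≡ ∑ xs λ x → ∑ (g x) f
∑-concatMap g []       f = refl
∑-concatMap g (x ∷ xs) f =
  trans (∑-++ (g x) (concatMap g xs) f) (cong (∑ (g x) f +ᶻ_) (∑-concatMap g xs f))

∑-zero : ∀ (xs : List A) {f} → (∀ x → x ∈ xs → f x ≡ 0ℤ) → ∑ xs f ≡ 0ℤ
∑-zero []       f≗0 = refl
∑-zero (x ∷ xs) f≗0 = cong₂ _+ᶻ_ (f≗0 x (here refl)) (∑-zero xs λ y y∈ → f≗0 y (there y∈))

∑-distrib-+ : ∀ (xs : List A) f g → ∑ xs (λ x → f x +ᶻ g x) ≡ ∑ xs f +ᶻ ∑ xs g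
∑-distrib-+ []       f g = refl
∑-distrib-+ (x ∷ xs) f g = trans (cong ((f x +ᶻ g x) +ᶻ_) (∑-distrib-+ xs f g)) (lem (f x) (g x) _ _)
  where
  lem : ∀ a b c d → (a +ᶻ b) +ᶻ (c +ᶻ d) ≡ (a +ᶻ c) +ᶻ (b +ᶻ d)
  lem = solve-∀

∑-distrib-- : ∀ (xs : List A) f g → ∑ xs (λ x → f x -ᶻ g x) ≡ ∑ xs f -ᶻ ∑ xs g
∑-distrib-- []       f g = refl
∑-distrib-- (x ∷ xs) f g = trans (cong ((f x -ᶻ g x) +ᶻ_) (∑-distrib-- xs f g)) (lem (f x) (g x) _ _)
  where
  lem : ∀ a b c d → (a -ᶻ b) +ᶻ (c -ᶻ d) ≡ (a +ᶻ c) -ᶻ (b +ᶻ d)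
  lem = solve-∀

∑-distrib-* : ∀ c (xs : List A) f → ∑ xs (λ x → c *ᶻ f x) ≡ c *ᶻ ∑ xs f
∑-distrib-* c []       f = sym (ℤₚ.*-zeroʳ c)
∑-distrib-* c (x ∷ xs) f =
  trans (cong (c *ᶻ f x +ᶻ_) (∑-distrib-* c xs f)) (sym (ℤₚ.*-distribˡ-+ c (f x) _))

∑-swap : ∀ (xs : List A) (ys : List B) (f : A → B → ℤ) →
  ∑ xs (λ x → ∑ ys λ y → f x y) ≡ ∑ ys (λ y → ∑ xs λ x → f x y)
∑-swap []       ys f = sym (∑-zero ys λ _ _ → refl)
∑-swap (x ∷ xs) ys f =
  trans (cong (∑ ys (f x) +ᶻ_) (∑-swap xs ys f)) (sym (∑-distrib-+ ys (f x) _))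

∑-upTo-cong : ∀ n {f g} → (∀ e → e < n → f e ≡ g e) → ∑ (upTo n) f ≡ ∑ (upTo n) g
∑-upTo-cong n f≗g = ∑-cong-∈ (upTo n) λ e e∈ → f≗g e (∈-upTo⁻ e∈)

∑-upTo-suc : ∀ n f → ∑ (upTo (suc n)) f ≡ f 0 +ᶻ ∑ (upTo n) (f ∘ suc)
∑-upTo-suc n f = cong (f 0 +ᶻ_)
  (trans (cong (λ xs → ∑ xs f) (sym (map-upTo suc n))) (∑-map suc (upTo n) f))

∑-upTo-last : ∀ n f → ∑ (upTo (suc n)) f ≡ ∑ (upTo n) f +ᶻ f n
∑-upTo-last n f = begin
  ∑ (upTo (suc n)) f               ≡⟨ cong (λ xs → ∑ xs f) (sym (upTo-∷ʳ n)) ⟩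
  ∑ (upTo n ++ [ n ]) f            ≡⟨ ∑-++ (upTo n) [ n ] f ⟩
  ∑ (upTo n) f +ᶻ (f n +ᶻ 0ℤ)    ≡⟨ cong (∑ (upTo n) f +ᶻ_) (ℤₚ.+-identityʳ (f n)) ⟩
  ∑ (upTo n) f +ᶻ f n             ∎

∑-upTo-+ : ∀ m n f → ∑ (upTo (m + n)) f ≡ ∑ (upTo m) f +ᶻ ∑ (upTo n) (λ e → f (m + e))
∑-upTo-+ zero    n f = sym (ℤₚ.+-identityˡ _)
∑-upTo-+ (suc m) n f = begin
  ∑ (upTo (suc m + n)) f
    ≡⟨ ∑-upTo-suc (m + n) f ⟩
  f 0 +ᶻ ∑ (upTo (m + n)) (f ∘ suc)
    ≡⟨ cong (f 0 +ᶻ_) (∑-upTo-+ m n (f ∘ suc)) ⟩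
  f 0 +ᶻ (∑ (upTo m) (f ∘ suc) +ᶻ ∑ (upTo n) (λ e → f (suc m + e)))
    ≡⟨ ℤₚ.+-assoc (f 0) _ _ ⟨
  (f 0 +ᶻ ∑ (upTo m) (f ∘ suc)) +ᶻ ∑ (upTo n) (λ e → f (suc m + e))
    ≡⟨ cong (_+ᶻ ∑ (upTo n) (λ e → f (suc m + e))) (∑-upTo-suc m f) ⟨
  ∑ (upTo (suc m)) f +ᶻ ∑ (upTo n) (λ e → f (suc m + e)) ∎

-- The first sum runs through the indices t + s - 1 down to s, the complement of the initial segment
-- of length s.
∑-upTo-reverse : ∀ t s f →
  ∑ (upTo t) (λ e → f (t + s ∸ suc e)) +ᶻ ∑ (upTo s) f ≡ ∑ (upTo (t + s)) f
∑-upTo-reverse zero    s f = ℤₚ.+-identityˡ _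
∑-upTo-reverse (suc t) s f = begin
  ∑ (upTo (suc t)) (λ e → f (t + s ∸ e)) +ᶻ ∑ (upTo s) f
    ≡⟨ cong (_+ᶻ ∑ (upTo s) f) (∑-upTo-suc t (λ e → f (t + s ∸ e))) ⟩
  (f (t + s) +ᶻ ∑ (upTo t) (λ e → f (t + s ∸ suc e))) +ᶻ ∑ (upTo s) f
    ≡⟨ ℤₚ.+-assoc (f (t + s)) _ _ ⟩
  f (t + s) +ᶻ (∑ (upTo t) (λ e → f (t + s ∸ suc e)) +ᶻ ∑ (upTo s) f)
    ≡⟨ cong (f (t + s) +ᶻ_) (∑-upTo-reverse t s f) ⟩
  f (t + s) +ᶻ ∑ (upTo (t + s)) f
    ≡⟨ ℤₚ.+-comm (f (t + s)) _ ⟩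
  ∑ (upTo (t + s)) f +ᶻ f (t + s)
    ≡⟨ ∑-upTo-last (t + s) f ⟨
  ∑ (upTo (suc t + s)) f ∎

range : ℕ → ℕ → List ℕ
range a b = map (a +_) (upTo (suc b ∸ a))

∑-range : ∀ a b f → ∑ (range a b) f ≡ ∑ (upTo (suc b ∸ a)) (λ e → f (a + e))
∑-range a b f = ∑-map (a +_) (upTo (suc b ∸ a)) f

∈-range⁻ : ∀ {a b j} → j ∈ range a b → a ≤ j × j ≤ b
∈-range⁻ {a} {b} j∈ with e , e∈ , refl ← ∈-map⁻ (a +_) j∈ =
  m≤m+n a e , ≤-pred (subst (_≤ suc b) (cong suc (+-comm e a))
    (m≤o∸n⇒m+n≤o (suc e) a≤ (∈-upTo⁻ e∈)))
  where
  a≤ : a ≤ suc b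
  a≤ with a ≤? suc b
  ... | yes p = p
  ... | no ¬p = contradiction (subst (e <_) (m≤n⇒m∸n≡0 (<⇒≤ (≰⇒> ¬p))) (∈-upTo⁻ e∈)) λ()

∈-range⁺ : ∀ {a b j} → a ≤ j → j ≤ b → j ∈ range a b
∈-range⁺ {a} {b} {j} a≤j j≤b =
  subst (_∈ range a b) (m+[n∸m]≡n a≤j)
    (∈-map⁺ (a +_)
      (∈-upTo⁺ (∸-monoˡ-< (s≤s j≤b) a≤j)))

∑-range-cong : ∀ a b {f g} → (∀ j → a ≤ j → j ≤ b → f j ≡ g j) → ∑ (range a b) f ≡ ∑ (range a b) g
∑-range-cong a b f≗g = ∑-cong-∈ (range a b) λ j j∈ → let p , q = ∈-range⁻ j∈ in f≗g j p q

∑-range-shift : ∀ c a b f → ∑ (range (c + a) (c + b)) f ≡ ∑ (range a b) (λ j → f (c + j))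
∑-range-shift c a b f = begin
  ∑ (range (c + a) (c + b)) f
    ≡⟨ ∑-range (c + a) (c + b) f ⟩
  ∑ (upTo (suc (c + b) ∸ (c + a))) (λ e → f (c + a + e))
    ≡⟨ cong (λ n → ∑ (upTo n) (λ e → f (c + a + e)))
         (trans (cong (_∸ (c + a)) (sym (+-suc c b))) ([m+n]∸[m+o]≡n∸o c (suc b) a)) ⟩
  ∑ (upTo (suc b ∸ a)) (λ e → f (c + a + e))
    ≡⟨ ∑-cong (upTo (suc b ∸ a)) (λ e → cong f (+-assoc c a e)) ⟩
  ∑ (upTo (suc b ∸ a)) (λ e → f (c + (a + e)))
    ≡⟨ ∑-range a b (λ j → f (c + j)) ⟨
  ∑ (range a b) (λ j → f (c + j)) ∎

-- ind turns a range into a summand condition, so that order of summation over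
-- triangular regions is exchanged by comparing the conditions.
ind : ∀ {P : Set} → Dec P → ℤ → ℤ
ind d x = if does d then x else 0ℤ

ind-yes : ∀ {P : Set} (d : Dec P) x → P → ind d x ≡ x
ind-yes d x p rewrite dec-true d p = refl

ind-no : ∀ {P : Set} (d : Dec P) x → ¬ P → ind d x ≡ 0ℤ
ind-no d x ¬p rewrite dec-false d ¬p = refl

ind-cong : ∀ {P Q : Set} (d : Dec P) (d′ : Dec Q) {x y} →
  (P → Q) → (Q → P) → (P → x ≡ y) → ind d x ≡ ind d′ y
ind-cong (yes p) (yes q) f g h = h p
ind-cong (yes p) (no ¬q) f g h = contradiction (f p) ¬q
ind-cong (no ¬p) (yes q) f g h = contradiction (g q) ¬p
ind-cong (no ¬p) (no ¬q) f g h = refl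

ind-∧ : ∀ {P Q : Set} (d : Dec P) (d′ : Dec Q) x → ind d (ind d′ x) ≡ ind (d ×-dec d′) x
ind-∧ (yes p) (yes q) x = refl
ind-∧ (yes p) (no ¬q) x = refl
ind-∧ (no ¬p) d′      x = refl

ind-∑ : ∀ {P : Set} (d : Dec P) (xs : List A) f → ind d (∑ xs f) ≡ ∑ xs (λ x → ind d (f x))
ind-∑ (yes p) xs f = refl
ind-∑ (no ¬p) xs f = sym (∑-zero xs λ _ _ → refl)

∑-range-ind : ∀ {N} a b f → b < N →
  ∑ (range a b) f ≡ ∑ (upTo N) (λ e → ind (a ≤? e ×-dec e ≤? b) (f e))
∑-range-ind {N} a b f b<N with a ≤? suc b
-- Truncated subtraction makes the range empty, and no `e` lies between `a` and `b`.
... | no a≰ = begin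
  ∑ (range a b) f             ≡⟨ ∑-range a b f ⟩
  ∑ (upTo (suc b ∸ a)) _      ≡⟨ cong (λ n → ∑ (upTo n) (λ e → f (a + e))) (m≤n⇒m∸n≡0 (<⇒≤ (≰⇒> a≰))) ⟩
  0ℤ                          ≡⟨ ∑-zero (upTo N) (λ e _ → ind-no (a ≤? e ×-dec e ≤? b) (f e)
                                   λ (p , q) → a≰ (≤-trans p (m≤n⇒m≤1+n q))) ⟨
  ∑ (upTo N) _                ∎
... | yes a≤ = sym (begin
  ∑ (upTo N) g
    ≡⟨ cong (λ n → ∑ (upTo n) g) (trans (cong (_+ r) (m+[n∸m]≡n a≤)) (m+[n∸m]≡n b<N)) ⟨
  ∑ (upTo (a + s + r)) g
    ≡⟨ ∑-upTo-+ (a + s) r g ⟩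
  ∑ (upTo (a + s)) g +ᶻ ∑ (upTo r) (λ e → g (a + s + e))
    ≡⟨ cong₂ _+ᶻ_ (∑-upTo-+ a s g) (∑-zero (upTo r) (λ e _ → ind-no (a ≤? a + s + e ×-dec a + s + e ≤? b) _
         λ (_ , q) → <-irrefl refl (≤-trans (≤-trans (≤-reflexive (sym (m+[n∸m]≡n a≤))) (m≤m+n (a + s) e)) q))) ⟩
  (∑ (upTo a) g +ᶻ ∑ (upTo s) (λ e → g (a + e))) +ᶻ 0ℤ
    ≡⟨ ℤₚ.+-identityʳ _ ⟩
  ∑ (upTo a) g +ᶻ ∑ (upTo s) (λ e → g (a + e))
    ≡⟨ cong₂ _+ᶻ_
         (trans (∑-upTo-cong a (λ e e<a → ind-no (a ≤? e ×-dec e ≤? b) _ λ (p , _) → <⇒≱ e<a p))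
                (∑-zero (upTo a) λ _ _ → refl))
         (∑-upTo-cong s (λ e e<s → ind-yes (a ≤? a + e ×-dec a + e ≤? b) _
            (m≤m+n a e , ≤-pred (subst (a + e <_) (m+[n∸m]≡n a≤) (+-monoʳ-< a e<s))))) ⟩
  0ℤ +ᶻ ∑ (upTo s) (λ e → f (a + e))
    ≡⟨ ℤₚ.+-identityˡ _ ⟩
  ∑ (upTo s) (λ e → f (a + e))
    ≡⟨ ∑-range a b f ⟨
  ∑ (range a b) f ∎)
  where
  s r : ℕ
  s = suc b ∸ a
  r = N ∸ suc b
  g : ℕ → ℤ
  g e = ind (a ≤? e ×-dec e ≤? b) (f e)

-- The last two hypotheses say that both iterated sums run over the same set of pairs (x , y). As
-- all coordinates are below `N`, both become sums over one square, where the summations commute.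
∑-range-exchange : ∀ N a b a′ b′ (c d c′ d′ : ℕ → ℕ) (f : ℕ → ℕ → ℤ) →
  b < N → b′ < N → (∀ x → x ≤ b → d x < N) → (∀ y → y ≤ b′ → d′ y < N) →
  (∀ x y → a ≤ x × x ≤ b → c x ≤ y × y ≤ d x → (a′ ≤ y × y ≤ b′) × (c′ y ≤ x × x ≤ d′ y)) →
  (∀ x y → a′ ≤ y × y ≤ b′ → c′ y ≤ x × x ≤ d′ y → (a ≤ x × x ≤ b) × (c x ≤ y × y ≤ d x)) →
  ∑ (range a b) (λ x → ∑ (range (c x) (d x)) (f x)) ≡
  ∑ (range a′ b′) (λ y → ∑ (range (c′ y) (d′ y)) (λ x → f x y))
∑-range-exchange N a b a′ b′ c d c′ d′ f b<N b′<N d<N d′<N to from = begin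
  ∑ (range a b) (λ x → ∑ (range (c x) (d x)) (f x))
    ≡⟨ indicators a b c d f b<N d<N ⟩
  ∑ (upTo N) (λ x → ∑ (upTo N) λ y → ind (I x ×-dec J x y) (f x y))
    ≡⟨ ∑-swap (upTo N) (upTo N) _ ⟩
  ∑ (upTo N) (λ y → ∑ (upTo N) λ x → ind (I x ×-dec J x y) (f x y))
    ≡⟨ ∑-cong (upTo N) (λ y → ∑-cong (upTo N) λ x → ind-cong (I x ×-dec J x y) (I′ y ×-dec J′ y x)
         (λ (p , q) → to x y p q) (λ (p , q) → from x y p q) (λ _ → refl)) ⟩
  ∑ (upTo N) (λ y → ∑ (upTo N) λ x → ind (I′ y ×-dec J′ y x) (f x y))
    ≡⟨ indicators a′ b′ c′ d′ (λ y x → f x y) b′<N d′<N ⟨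
  ∑ (range a′ b′) (λ y → ∑ (range (c′ y) (d′ y)) (λ x → f x y)) ∎
  where
  I  = λ x → a ≤? x ×-dec x ≤? b
  J  = λ x y → c x ≤? y ×-dec y ≤? d x
  I′ = λ y → a′ ≤? y ×-dec y ≤? b′
  J′ = λ y x → c′ y ≤? x ×-dec x ≤? d′ y
  indicators : ∀ a b (c d : ℕ → ℕ) (f : ℕ → ℕ → ℤ) → b < N → (∀ x → x ≤ b → d x < N) →
    ∑ (range a b) (λ x → ∑ (range (c x) (d x)) (f x)) ≡
    ∑ (upTo N) (λ x → ∑ (upTo N) λ y →
      ind ((a ≤? x ×-dec x ≤? b) ×-dec (c x ≤? y ×-dec y ≤? d x)) (f x y))
  indicators a b c d f b<N d<N = trans (∑-range-ind a b _ b<N) (∑-cong (upTo N) λ x → trans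
    (ind-cong (a ≤? x ×-dec x ≤? b) (a ≤? x ×-dec x ≤? b) (λ p → p) (λ p → p)
      λ (_ , x≤b) → ∑-range-ind (c x) (d x) (f x) (d<N x x≤b))
    (trans (ind-∑ (a ≤? x ×-dec x ≤? b) (upTo N) _)
           (∑-cong (upTo N) λ y → ind-∧ (a ≤? x ×-dec x ≤? b) (c x ≤? y ×-dec y ≤? d x) (f x y))))

-- Divided differences of two-variable monomials

-- Pairing of `ψ` with the terms x^e y^(N-1-e), e < t, of the complete homogeneous polynomial of
-- degree N - 1.
H : ℕ → ℕ → (ℕ → ℕ → ℤ) → ℤ
H N t ψ = ∑ (upTo t) λ e → ψ e (N ∸ suc e)

-- D a b ψ is the pairing of ψ with ∂(x^a y^b); as a difference of two initial
-- segments of the antidiagonal of degree a + b - 1, it needs no case distinction.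
D : ℕ → ℕ → (ℕ → ℕ → ℤ) → ℤ
D a b ψ = H (a + b) a ψ -ᶻ H (a + b) b ψ

H-cong : ∀ N t {ψ χ} → (∀ e e′ → ψ e e′ ≡ χ e e′) → H N t ψ ≡ H N t χ
H-cong N t ψ≗χ = ∑-cong (upTo t) λ e → ψ≗χ e _

D-cong : ∀ a b {ψ χ} → (∀ e e′ → ψ e e′ ≡ χ e e′) → D a b ψ ≡ D a b χ
D-cong a b ψ≗χ = cong₂ _-ᶻ_ (H-cong (a + b) a ψ≗χ) (H-cong (a + b) b ψ≗χ)

D-∑ : ∀ a b (xs : List A) (ψ : A → ℕ → ℕ → ℤ) →
  D a b (λ e e′ → ∑ xs λ x → ψ x e e′) ≡ ∑ xs λ x → D a b (ψ x)
D-∑ a b xs ψ = begin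
  D a b (λ e e′ → ∑ xs λ x → ψ x e e′)
    ≡⟨ cong₂ _-ᶻ_ (∑-swap (upTo a) xs λ e x → ψ x e (a + b ∸ suc e))
                  (∑-swap (upTo b) xs λ e x → ψ x e (a + b ∸ suc e)) ⟩
  ∑ xs (λ x → H (a + b) a (ψ x)) -ᶻ ∑ xs (λ x → H (a + b) b (ψ x))
    ≡⟨ ∑-distrib-- xs (λ x → H (a + b) a (ψ x)) (λ x → H (a + b) b (ψ x)) ⟨
  ∑ xs (λ x → D a b (ψ x)) ∎

-- Past its first `c` terms, the antidiagonal of degree N - 1 continues as x^c y^d times the one of
-- degree M - 1; `t ≤ M` keeps the truncated exponent of y exact.
H-shift : ∀ N M c d t ψ → N ≡ c + (d + M) → t ≤ M →
  H N (c + t) ψ ≡ H N c ψ +ᶻ H M t (λ e e′ → ψ (c + e) (d + e′))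
H-shift N M c d t ψ N≡ t≤M = trans (∑-upTo-+ c t _) (cong (H N c ψ +ᶻ_)
  (∑-upTo-cong t λ e e<t → cong (ψ (c + e)) (begin
    N ∸ suc (c + e)              ≡⟨ cong₂ _∸_ N≡ (sym (+-suc c e)) ⟩
    c + (d + M) ∸ (c + suc e)    ≡⟨ [m+n]∸[m+o]≡n∸o c (d + M) (suc e) ⟩
    d + M ∸ suc e                ≡⟨ +-∸-assoc d (≤-trans e<t t≤M) ⟩
    d + (M ∸ suc e)              ∎)))

-- The twisted Leibniz rule ∂(fg) = ∂(f) g + s(f) ∂(g) for f = x^a y^b and g = x^c y^d. After the
-- shifts, the two terms are the stretches of one antidiagonal between a + c and b + c and between b
-- + c and b + d, so the sum telescopes at b + c.
D-leibniz : ∀ a b c d ψ → D (a + c) (b + d) ψ ≡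
  D a b (λ e e′ → ψ (c + e) (d + e′)) +ᶻ D c d (λ e e′ → ψ (b + e) (a + e′))
D-leibniz a b c d ψ = sym (begin
  (H (a + b) a ψ₁ -ᶻ H (a + b) b ψ₁) +ᶻ (H (c + d) c ψ₂ -ᶻ H (c + d) d ψ₂)
    ≡⟨ lem (H N c ψ) (H (a + b) a ψ₁) (H (a + b) b ψ₁) (H N b ψ) (H (c + d) c ψ₂) (H (c + d) d ψ₂) ⟩
  (H N c ψ +ᶻ H (a + b) a ψ₁) -ᶻ (H N c ψ +ᶻ H (a + b) b ψ₁) +ᶻ
  ((H N b ψ +ᶻ H (c + d) c ψ₂) -ᶻ (H N b ψ +ᶻ H (c + d) d ψ₂))
    ≡⟨ cong₂ _+ᶻ_
         (cong₂ _-ᶻ_ (H-shift N (a + b) c d a ψ N≡₁ (m≤m+n a b)) (H-shift N (a + b) c d b ψ N≡₁ (m≤n+m b a)))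
         (cong₂ _-ᶻ_ (H-shift N (c + d) b a c ψ N≡₂ (m≤m+n c d)) (H-shift N (c + d) b a d ψ N≡₂ (m≤n+m d c))) ⟨
  H N (c + a) ψ -ᶻ H N (c + b) ψ +ᶻ (H N (b + c) ψ -ᶻ H N (b + d) ψ)
    ≡⟨ cong₂ (λ x y → H N x ψ -ᶻ H N y ψ +ᶻ (H N (b + c) ψ -ᶻ H N (b + d) ψ)) (+-comm c a) (+-comm c b) ⟩
  H N (a + c) ψ -ᶻ H N (b + c) ψ +ᶻ (H N (b + c) ψ -ᶻ H N (b + d) ψ)
    ≡⟨ lem′ (H N (a + c) ψ) (H N (b + c) ψ) (H N (b + d) ψ) ⟩
  H N (a + c) ψ -ᶻ H N (b + d) ψ ∎)
  where
  N = (a + c) + (b + d)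
  ψ₁ ψ₂ : ℕ → ℕ → ℤ
  ψ₁ e e′ = ψ (c + e) (d + e′)
  ψ₂ e e′ = ψ (b + e) (a + e′)
  N≡₁ : N ≡ c + (d + (a + b))
  N≡₁ = eq a b c d where
    eq : ∀ a b c d → (a + c) + (b + d) ≡ c + (d + (a + b))
    eq = ℕ-Solver.solve-∀
  N≡₂ : N ≡ b + (a + (c + d))
  N≡₂ = eq a b c d where
    eq : ∀ a b c d → (a + c) + (b + d) ≡ b + (a + (c + d))
    eq = ℕ-Solver.solve-∀
  lem : ∀ u p q v r s → (p -ᶻ q) +ᶻ (r -ᶻ s) ≡ (u +ᶻ p) -ᶻ (u +ᶻ q) +ᶻ ((v +ᶻ r) -ᶻ (v +ᶻ s))
  lem = solve-∀
  lem′ : ∀ p q r → p -ᶻ q +ᶻ (q -ᶻ r) ≡ p -ᶻ r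
  lem′ = solve-∀

-- The factor x^c y^c is symmetric: the second Leibniz term is a `D c c`, which vanishes.
D-shift : ∀ c a b ψ → D (c + a) (c + b) ψ ≡ D a b (λ e e′ → ψ (c + e) (c + e′))
D-shift c a b ψ = begin
  D (c + a) (c + b) ψ
    ≡⟨ cong₂ (λ x y → D x y ψ) (+-comm c a) (+-comm c b) ⟩
  D (a + c) (b + c) ψ
    ≡⟨ D-leibniz a b c c ψ ⟩
  D a b (λ e e′ → ψ (c + e) (c + e′)) +ᶻ D c c (λ e e′ → ψ (b + e) (a + e′))
    ≡⟨ cong (D a b (λ e e′ → ψ (c + e) (c + e′)) +ᶻ_) (ℤₚ.+-inverseʳ (H (c + c) c λ e e′ → ψ (b + e) (a + e′))) ⟩
  D a b (λ e e′ → ψ (c + e) (c + e′)) +ᶻ 0ℤ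
    ≡⟨ ℤₚ.+-identityʳ _ ⟩
  D a b (λ e e′ → ψ (c + e) (c + e′)) ∎

D-upTo : ∀ d b ψ → D (b + d) b ψ ≡ ∑ (upTo d) λ e → ψ (b + e) (b + d ∸ suc e)
D-upTo d b ψ = begin
  H N (b + d) ψ -ᶻ H N b ψ
    ≡⟨ cong (_-ᶻ H N b ψ) (H-shift N d b b d ψ (eq b d) ≤-refl) ⟩
  (H N b ψ +ᶻ X) -ᶻ H N b ψ
    ≡⟨ lem (H N b ψ) X ⟩
  X
    ≡⟨ ∑-upTo-cong d (λ e e<d → cong (ψ (b + e)) (sym (+-∸-assoc b e<d))) ⟩
  ∑ (upTo d) (λ e → ψ (b + e) (b + d ∸ suc e)) ∎
  where
  N = b + d + b
  X = H d d (λ e e′ → ψ (b + e) (b + e′))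
  eq : ∀ b d → b + d + b ≡ b + (b + d)
  eq = ℕ-Solver.solve-∀
  lem : ∀ u v → (u +ᶻ v) -ᶻ u ≡ v
  lem = solve-∀

-- This is π(x^a y^b) = s_(a,b)(x, y), listed by the exponent of x.
D-string : ∀ {a b} ψ → b ≤ a → D (suc a) b ψ ≡ ∑ (range b a) λ j → ψ j (a ∸ j + b)
D-string {a} {b} ψ b≤a = begin
  D (suc a) b ψ
    ≡⟨ cong (λ x → D x b ψ) (m+[n∸m]≡n b≤1+a) ⟨
  D (b + (suc a ∸ b)) b ψ
    ≡⟨ D-upTo (suc a ∸ b) b ψ ⟩
  ∑ (upTo (suc a ∸ b)) (λ e → ψ (b + e) (b + (suc a ∸ b) ∸ suc e))
    ≡⟨ ∑-upTo-cong (suc a ∸ b) (λ e e< → cong (ψ (b + e)) (exponent e e<)) ⟩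
  ∑ (upTo (suc a ∸ b)) (λ e → ψ (b + e) (a ∸ (b + e) + b))
    ≡⟨ ∑-range b a _ ⟨
  ∑ (range b a) (λ j → ψ j (a ∸ j + b)) ∎
  where
  b≤1+a = m≤n⇒m≤1+n b≤a
  exponent : ∀ e → e < suc a ∸ b → b + (suc a ∸ b) ∸ suc e ≡ a ∸ (b + e) + b
  exponent e e< = begin
    b + (suc a ∸ b) ∸ suc e   ≡⟨ +-∸-assoc b e< ⟩
    b + (suc a ∸ b ∸ suc e)   ≡⟨ cong (b +_) (∸-+-assoc (suc a) b (suc e)) ⟩
    b + (suc a ∸ (b + suc e)) ≡⟨ cong (λ x → b + (suc a ∸ x)) (+-suc b e) ⟩
    b + (a ∸ (b + e))         ≡⟨ +-comm b _ ⟩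
    a ∸ (b + e) + b           ∎

D-neg : ∀ a b ψ → D a b ψ ≡ ℤ.- D b a ψ
D-neg a b ψ rewrite +-comm b a = lem (H (a + b) a ψ) (H (a + b) b ψ)
  where
  lem : ∀ u v → u -ᶻ v ≡ ℤ.- (v -ᶻ u)
  lem = solve-∀

-- The inner divided difference is antisymmetric in (e, e′), while the outer one
-- sums over a set of (e, e′) that is closed under the exchange.
D∘D : ∀ a b ψ → D a b (λ e e′ → D e e′ ψ) ≡ 0ℤ
D∘D a b ψ = begin
  D a b (λ e e′ → D e e′ ψ)
    ≡⟨ cong₂ _-ᶻ_ (segment a b refl) (segment b a (+-comm a b)) ⟩
  (S a +ᶻ S b -ᶻ S (a + b)) -ᶻ (S b +ᶻ S a -ᶻ S (a + b))
    ≡⟨ lem (S a) (S b) (S (a + b)) ⟩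
  0ℤ ∎
  where
  G : ℕ → ℤ
  G e = H (a + b ∸ 1) e ψ
  S : ℕ → ℤ
  S n = ∑ (upTo n) G
  lem : ∀ x y z → (x +ᶻ y -ᶻ z) -ᶻ (y +ᶻ x -ᶻ z) ≡ 0ℤ
  lem = solve-∀
  lem₂ : ∀ x y z → x -ᶻ y ≡ x +ᶻ z -ᶻ (y +ᶻ z)
  lem₂ = solve-∀
  degree : ∀ {N e} → e < N → e + (N ∸ suc e) ≡ N ∸ 1
  degree {suc N} (s≤s e≤N) = m+[n∸m]≡n e≤N
  segment : ∀ t s → a + b ≡ t + s → H (a + b) t (λ e e′ → D e e′ ψ) ≡ S t +ᶻ S s -ᶻ S (a + b)
  segment t s eq = begin
    H (a + b) t (λ e e′ → D e e′ ψ)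
      -- The exponents e and a + b - (e + 1) always add up to a + b - 1, so every inner difference
      -- is a difference of two values of the single function `G`.
      ≡⟨ ∑-upTo-cong t (λ e e<t → cong₂ _-ᶻ_
           (cong (λ x → H x e ψ) (degree (≤-trans e<t t≤)))
           (cong (λ x → H x (a + b ∸ suc e) ψ) (degree (≤-trans e<t t≤)))) ⟩
    ∑ (upTo t) (λ e → G e -ᶻ G (a + b ∸ suc e))
      ≡⟨ ∑-distrib-- (upTo t) G (λ e → G (a + b ∸ suc e)) ⟩
    S t -ᶻ ∑ (upTo t) (λ e → G (a + b ∸ suc e))
      ≡⟨ lem₂ (S t) _ (S s) ⟩
    S t +ᶻ S s -ᶻ (∑ (upTo t) (λ e → G (a + b ∸ suc e)) +ᶻ S s)
      ≡⟨ cong (λ x → S t +ᶻ S s -ᶻ x) (trans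
           (cong (λ N → ∑ (upTo t) (λ e → G (N ∸ suc e)) +ᶻ S s) eq)
           (trans (∑-upTo-reverse t s G) (cong S (sym eq)))) ⟩
    S t +ᶻ S s -ᶻ S (a + b) ∎
    where
    t≤ : t ≤ a + b
    t≤ = subst (t ≤_) (sym eq) (m≤m+n t s)

-- The divided differences on linear functionals

⟨_,_⟩ : Poly → (Exp → ℤ) → ℤ
⟨ f , φ ⟩ = ∑ f λ t → proj₂ t *ᶻ φ (proj₁ t)

δ : ℕ → (Exp → ℤ) → Exp → ℤ
δ i φ α = ⟨ ∂term i (α , 1ℤ) , φ ⟩

⟨map,⟩ : ∀ u (xs : List A) (e : A → Exp) φ → ⟨ map (λ x → e x , u) xs , φ ⟩ ≡ u *ᶻ ∑ xs (φ ∘ e)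
⟨map,⟩ u xs e φ = trans (∑-map (λ x → e x , u) xs _) (∑-distrib-* u xs (φ ∘ e))

∂term-scale : ∀ i α c φ → ⟨ ∂term i (α , c) , φ ⟩ ≡ c *ᶻ δ i φ α
∂term-scale i α c φ with at α (suc i) <ᵇ at α i | at α i <ᵇ at α (suc i)
... | true  | _     = trans (⟨map,⟩ c (upTo (at α i ∸ at α (suc i))) _ φ)
  (cong (c *ᶻ_) (sym (trans (⟨map,⟩ 1ℤ (upTo (at α i ∸ at α (suc i))) _ φ) (ℤₚ.*-identityˡ _))))
... | false | true  = trans (⟨map,⟩ (ℤ.- c) (upTo (at α (suc i) ∸ at α i)) _ φ) (trans (lem c _)
  (cong (c *ᶻ_) (sym (⟨map,⟩ (ℤ.- 1ℤ) (upTo (at α (suc i) ∸ at α i)) _ φ))))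
  where
  lem : ∀ c x → ℤ.- c *ᶻ x ≡ c *ᶻ (ℤ.- 1ℤ *ᶻ x)
  lem = solve-∀
... | false | false = sym (ℤₚ.*-zeroʳ c)

⟨∂,⟩ : ∀ i f φ → ⟨ ∂ i f , φ ⟩ ≡ ⟨ f , δ i φ ⟩
⟨∂,⟩ i f φ = trans (∑-concatMap (∂term i) f _) (∑-cong f λ t → ∂term-scale i (proj₁ t) (proj₂ t) φ)

at-++ : ∀ σ a τ → at (σ ++ a ∷ τ) (length σ) ≡ a
at-++ []      a τ = refl
at-++ (x ∷ σ) a τ = at-++ σ a τ

at-++-suc : ∀ σ a b τ → at (σ ++ a ∷ b ∷ τ) (suc (length σ)) ≡ b
at-++-suc []      a b τ = refl
at-++-suc (x ∷ σ) a b τ = at-++-suc σ a b τ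

set-++ : ∀ σ a τ v → set (σ ++ a ∷ τ) (length σ) v ≡ σ ++ v ∷ τ
set-++ []      a τ v = refl
set-++ (x ∷ σ) a τ v = cong (x ∷_) (set-++ σ a τ v)

set-++-suc : ∀ σ a b τ v → set (σ ++ a ∷ b ∷ τ) (suc (length σ)) v ≡ σ ++ a ∷ v ∷ τ
set-++-suc []      a b τ v = refl
set-++-suc (x ∷ σ) a b τ v = cong (x ∷_) (set-++-suc σ a b τ v)

set-set-++ : ∀ σ a b τ u v →
  set (set (σ ++ a ∷ b ∷ τ) (length σ) u) (suc (length σ)) v ≡ σ ++ u ∷ v ∷ τ
set-set-++ σ a b τ u v =
  trans (cong (λ α → set α (suc (length σ)) v) (set-++ σ a (b ∷ τ) u)) (set-++-suc σ u b τ v)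

length-set : ∀ xs i v → length (set xs i v) ≡ length xs
length-set []       i       v = refl
length-set (x ∷ xs) zero    v = refl
length-set (x ∷ xs) (suc i) v = cong suc (length-set xs i v)

-- Reduces `δ` to two variables and removes the case distinction of `∂term`: antisymmetry of `D`
-- covers a < b, and the vanishing of `D b b` covers a = b.
δ-split : ∀ σ a b τ φ → δ (length σ) φ (σ ++ a ∷ b ∷ τ) ≡ D a b (λ e e′ → φ (σ ++ e ∷ e′ ∷ τ))
δ-split σ a b τ φ rewrite at-++ σ a (b ∷ τ) | at-++-suc σ a b τ = compare
  where
  α = σ ++ a ∷ b ∷ τ
  i = length σ
  ψ : ℕ → ℕ → ℤ
  ψ e e′ = φ (σ ++ e ∷ e′ ∷ τ)

  descent : ∀ {u v} → v < u →
    ∑ (upTo (u ∸ v)) (λ k → φ (set (set α i (v + k)) (suc i) (u ∸ 1 ∸ k))) ≡ D u v ψ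
  descent {u} {v} v<u = begin
    ∑ (upTo (u ∸ v)) (λ k → φ (set (set α i (v + k)) (suc i) (u ∸ 1 ∸ k)))
      ≡⟨ ∑-cong (upTo (u ∸ v)) (λ k → trans
           (cong φ (set-set-++ σ a b τ (v + k) (u ∸ 1 ∸ k))) (cong (ψ (v + k)) (∸-+-assoc u 1 k))) ⟩
    ∑ (upTo (u ∸ v)) (λ k → ψ (v + k) (u ∸ suc k))
      ≡⟨ cong (λ x → ∑ (upTo (u ∸ v)) (λ k → ψ (v + k) (x ∸ suc k))) (m+[n∸m]≡n (<⇒≤ v<u)) ⟨
    ∑ (upTo (u ∸ v)) (λ k → ψ (v + k) (v + (u ∸ v) ∸ suc k))
      ≡⟨ D-upTo (u ∸ v) v ψ ⟨
    D (v + (u ∸ v)) v ψ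
      ≡⟨ cong (λ x → D x v ψ) (m+[n∸m]≡n (<⇒≤ v<u)) ⟩
    D u v ψ ∎

  string : ℤ → ℕ → ℕ → Poly
  string c u v = map (λ k → set (set α i (v + k)) (suc i) (u ∸ 1 ∸ k) , c) (upTo (u ∸ v))

  compare : ⟨ (if b <ᵇ a then string 1ℤ a b else if a <ᵇ b then string (ℤ.- 1ℤ) b a else []) , φ ⟩ ≡ D a b ψ
  compare with <-cmp a b
  ... | tri> a≮b a≢b b<a rewrite dec-true (b <? a) b<a =
    trans (⟨map,⟩ 1ℤ (upTo (a ∸ b)) _ φ) (trans (ℤₚ.*-identityˡ _) (descent b<a))
  ... | tri≈ a≮b a≡b b≮a rewrite dec-false (b <? a) b≮a | dec-false (a <? b) a≮b | a≡b =
    sym (ℤₚ.+-inverseʳ (H (b + b) b ψ))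
  ... | tri< a<b a≢b b≮a rewrite dec-false (b <? a) b≮a | dec-true (a <? b) a<b =
    trans (⟨map,⟩ (ℤ.- 1ℤ) (upTo (b ∸ a)) _ φ) (trans (ℤₚ.-1*i≡-i _)
      (trans (cong ℤ.-_ (descent a<b)) (sym (D-neg a b ψ))))

-- Matching on this view exposes the two entries on which ∂_i acts, with `i` turned into the length
-- of the prefix.
data Split : ℕ → List ℕ → Set where
  split : ∀ σ a b τ → Split (length σ) (σ ++ a ∷ b ∷ τ)

splitAt : ∀ i α → 2 + i ≤ length α → Split i α
splitAt zero    (a ∷ b ∷ α) _ = split [] a b α
splitAt zero    (a ∷ [])    (s≤s ())
splitAt (suc i) (x ∷ α) (s≤s le) with splitAt i α le
... | split σ a b τ = split (x ∷ σ) a b τ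

δ-cong : ∀ i α {φ χ} → 2 + i ≤ length α → (∀ γ → length γ ≡ length α → φ γ ≡ χ γ) → δ i φ α ≡ δ i χ α
δ-cong i α {φ} {χ} i< φ≗χ with splitAt i α i<
... | split σ a b τ = begin
  δ (length σ) φ (σ ++ a ∷ b ∷ τ)        ≡⟨ δ-split σ a b τ φ ⟩
  D a b (λ e e′ → φ (σ ++ e ∷ e′ ∷ τ))   ≡⟨ D-cong a b (λ e e′ → φ≗χ (σ ++ e ∷ e′ ∷ τ)
                                                (trans (length-++ σ) (sym (length-++ σ)))) ⟩
  D a b (λ e e′ → χ (σ ++ e ∷ e′ ∷ τ))   ≡⟨ δ-split σ a b τ χ ⟨
  δ (length σ) χ (σ ++ a ∷ b ∷ τ)        ∎

δ-++ˡ : ∀ i σ τ φ → 2 + i ≤ length σ → δ i φ (σ ++ τ) ≡ δ i (λ γ → φ (γ ++ τ)) σ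
δ-++ˡ i σ τ φ i< with splitAt i σ i<
... | split ρ a b υ = begin
  δ (length ρ) φ ((ρ ++ a ∷ b ∷ υ) ++ τ)
    ≡⟨ cong (δ (length ρ) φ) (++-assoc ρ (a ∷ b ∷ υ) τ) ⟩
  δ (length ρ) φ (ρ ++ a ∷ b ∷ υ ++ τ)
    ≡⟨ δ-split ρ a b (υ ++ τ) φ ⟩
  D a b (λ e e′ → φ (ρ ++ e ∷ e′ ∷ υ ++ τ))
    ≡⟨ D-cong a b (λ e e′ → cong φ (++-assoc ρ (e ∷ e′ ∷ υ) τ)) ⟨
  D a b (λ e e′ → φ ((ρ ++ e ∷ e′ ∷ υ) ++ τ))
    ≡⟨ δ-split ρ a b υ (λ γ → φ (γ ++ τ)) ⟨
  δ (length ρ) (λ γ → φ (γ ++ τ)) (ρ ++ a ∷ b ∷ υ) ∎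

δ-++ʳ : ∀ i π σ φ → 2 + i ≤ length σ → δ (length π + i) φ (π ++ σ) ≡ δ i (λ γ → φ (π ++ γ)) σ
δ-++ʳ i π σ φ i< with splitAt i σ i<
... | split ρ a b υ = begin
  δ (length π + length ρ) φ (π ++ ρ ++ a ∷ b ∷ υ)
    ≡⟨ cong₂ (λ x y → δ x φ y) (length-++ π) (++-assoc π ρ (a ∷ b ∷ υ)) ⟨
  δ (length (π ++ ρ)) φ ((π ++ ρ) ++ a ∷ b ∷ υ)
    ≡⟨ δ-split (π ++ ρ) a b υ φ ⟩
  D a b (λ e e′ → φ ((π ++ ρ) ++ e ∷ e′ ∷ υ))
    ≡⟨ D-cong a b (λ e e′ → cong φ (++-assoc π ρ (e ∷ e′ ∷ υ))) ⟩
  D a b (λ e e′ → φ (π ++ ρ ++ e ∷ e′ ∷ υ))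
    ≡⟨ δ-split ρ a b υ (λ γ → φ (π ++ γ)) ⟨
  δ (length ρ) (λ γ → φ (π ++ γ)) (ρ ++ a ∷ b ∷ υ) ∎

δ-∑ : ∀ i α (xs : List A) (φ : A → Exp → ℤ) →
  δ i (λ γ → ∑ xs λ x → φ x γ) α ≡ ∑ xs λ x → δ i (φ x) α
δ-∑ i α xs φ = trans
  (∑-cong (∂term i (α , 1ℤ)) λ t → sym (∑-distrib-* (proj₂ t) xs λ x → φ x (proj₁ t)))
  (∑-swap (∂term i (α , 1ℤ)) xs λ t x → proj₂ t *ᶻ φ x (proj₁ t))

-- Transposition reverses composition: the head of the word is the outermost divided difference of
-- `foldr ∂`, hence the first to act on `φ`.
δ* : List ℕ → (Exp → ℤ) → Exp → ℤ
δ* []       φ = φ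
δ* (i ∷ is) φ = δ* is (δ i φ)

δ*-++ : ∀ is js φ α → δ* (is ++ js) φ α ≡ δ* js (δ* is φ) α
δ*-++ []       js φ α = refl
δ*-++ (i ∷ is) js φ α = δ*-++ is js (δ i φ) α

δ*-cong : ∀ is α {φ χ} → All (λ i → 2 + i ≤ length α) is →
  (∀ γ → length γ ≡ length α → φ γ ≡ χ γ) → δ* is φ α ≡ δ* is χ α
δ*-cong []       α []        φ≗χ = φ≗χ α refl
δ*-cong (i ∷ is) α (i< ∷ is<) φ≗χ = δ*-cong is α is< λ γ γ≡ →
  δ-cong i γ (subst (2 + i ≤_) (sym γ≡) i<) λ γ′ γ′≡ → φ≗χ γ′ (trans γ′≡ γ≡)

δ*-++ˡ : ∀ is σ τ φ → All (λ i → 2 + i ≤ length σ) is →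
  δ* is φ (σ ++ τ) ≡ δ* is (λ γ → φ (γ ++ τ)) σ
δ*-++ˡ []       σ τ φ []         = refl
δ*-++ˡ (i ∷ is) σ τ φ (i< ∷ is<) = trans (δ*-++ˡ is σ τ (δ i φ) is<)
  (δ*-cong is σ is< λ γ γ≡ → δ-++ˡ i γ τ φ (subst (2 + i ≤_) (sym γ≡) i<))

δ*-++ʳ : ∀ is π σ φ → All (λ i → 2 + i ≤ length σ) is →
  δ* (map (length π +_) is) φ (π ++ σ) ≡ δ* is (λ γ → φ (π ++ γ)) σ
δ*-++ʳ []       π σ φ []         = refl
δ*-++ʳ (i ∷ is) π σ φ (i< ∷ is<) = trans (δ*-++ʳ is π σ (δ (length π + i) φ) is<)
  (δ*-cong is σ is< λ γ γ≡ → δ-++ʳ i π γ φ (subst (2 + i ≤_) (sym γ≡) i<))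

⟨foldr-∂,⟩ : ∀ is f φ → ⟨ foldr ∂ f is , φ ⟩ ≡ ⟨ f , δ* is φ ⟩
⟨foldr-∂,⟩ []       f φ = refl
⟨foldr-∂,⟩ (i ∷ is) f φ = trans (⟨∂,⟩ i (foldr ∂ f is) φ) (⟨foldr-∂,⟩ is f (δ i φ))

-- Products of monomials and the Leibniz rule

infixl 7 _⊞_

_⊞_ : Exp → Exp → Exp
_⊞_ = zipWith _+_

⊞-++ : ∀ σ σ′ {τ τ′} → length σ ≡ length σ′ → (σ ++ τ) ⊞ (σ′ ++ τ′) ≡ (σ ⊞ σ′) ++ (τ ⊞ τ′)
⊞-++ []      []        eq = refl
⊞-++ (x ∷ σ) (y ∷ σ′) eq = cong (x + y ∷_) (⊞-++ σ σ′ (suc-injective eq))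

length-⊞ : ∀ σ σ′ → length σ ≡ length σ′ → length (σ ⊞ σ′) ≡ length σ
length-⊞ []      []        eq = refl
length-⊞ (x ∷ σ) (y ∷ σ′) eq = cong suc (length-⊞ σ σ′ (suc-injective eq))

⊞-cancelʳ : ∀ α α′ σ → length α ≡ length σ → length α′ ≡ length σ → α ⊞ σ ≡ α′ ⊞ σ → α ≡ α′
⊞-cancelʳ []      []       []      _ _ _ = refl
⊞-cancelʳ (x ∷ α) (y ∷ α′) (s ∷ σ) p q eq =
  cong₂ _∷_ (+-cancelʳ-≡ s x y (∷-injectiveˡ eq))
    (⊞-cancelʳ α α′ σ (suc-injective p) (suc-injective q) (∷-injectiveʳ eq))

⊞-zeroʳ : ∀ α → α ⊞ replicate (length α) 0 ≡ α
⊞-zeroʳ []      = refl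
⊞-zeroʳ (x ∷ α) = cong₂ _∷_ (+-identityʳ x) (⊞-zeroʳ α)

swapAt-++ : ∀ σ a b τ → swapAt (length σ) (σ ++ a ∷ b ∷ τ) ≡ σ ++ b ∷ a ∷ τ
swapAt-++ σ a b τ = trans
  (cong₂ (λ u v → set (set (σ ++ a ∷ b ∷ τ) (length σ) u) (suc (length σ)) v)
    (at-++-suc σ a b τ) (at-++ σ a (b ∷ τ)))
  (set-set-++ σ a b τ b a)

-- The twist s_i(x^α) is `swapAt i α`. Only the second term differentiates `β`, and it vanishes once
-- `β` is summed over a symmetric polynomial.
δ-leibniz : ∀ i α β φ → length α ≡ length β → 2 + i ≤ length α →
  δ i φ (α ⊞ β) ≡ δ i (λ γ → φ (γ ⊞ β)) α +ᶻ δ i (λ γ → φ (swapAt i α ⊞ γ)) β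
δ-leibniz i α β φ len i< with splitAt i α i<
... | split σ a b τ = go β len (splitAt (length σ) β (subst (2 + length σ ≤_) len i<)) refl
  where
  go : ∀ {j} β → length (σ ++ a ∷ b ∷ τ) ≡ length β → Split j β → j ≡ length σ →
    δ (length σ) φ ((σ ++ a ∷ b ∷ τ) ⊞ β) ≡
    δ (length σ) (λ γ → φ (γ ⊞ β)) (σ ++ a ∷ b ∷ τ) +ᶻ
    δ (length σ) (λ γ → φ (swapAt (length σ) (σ ++ a ∷ b ∷ τ) ⊞ γ)) β
  go .(σ′ ++ c ∷ d ∷ τ′) len (split σ′ c d τ′) σ′≡ = begin
    δ n φ ((σ ++ a ∷ b ∷ τ) ⊞ (σ′ ++ c ∷ d ∷ τ′))
      ≡⟨ cong (δ n φ) (⊞-++ σ σ′ (sym σ′≡)) ⟩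
    δ n φ ((σ ⊞ σ′) ++ a + c ∷ b + d ∷ τ ⊞ τ′)
      ≡⟨ cong (λ m → δ m φ ((σ ⊞ σ′) ++ a + c ∷ b + d ∷ τ ⊞ τ′)) (length-⊞ σ σ′ (sym σ′≡)) ⟨
    δ (length (σ ⊞ σ′)) φ ((σ ⊞ σ′) ++ a + c ∷ b + d ∷ τ ⊞ τ′)
      ≡⟨ δ-split (σ ⊞ σ′) (a + c) (b + d) (τ ⊞ τ′) φ ⟩
    D (a + c) (b + d) (λ e e′ → φ ((σ ⊞ σ′) ++ e ∷ e′ ∷ τ ⊞ τ′))
      ≡⟨ D-leibniz a b c d ψ ⟩
    D a b (λ e e′ → φ ((σ ⊞ σ′) ++ c + e ∷ d + e′ ∷ τ ⊞ τ′)) +ᶻ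
    D c d (λ e e′ → φ ((σ ⊞ σ′) ++ b + e ∷ a + e′ ∷ τ ⊞ τ′))
      ≡⟨ cong₂ _+ᶻ_
           (D-cong a b {χ = λ e e′ → φ ((σ ++ e ∷ e′ ∷ τ) ⊞ (σ′ ++ c ∷ d ∷ τ′))} λ e e′ → cong φ (trans
             (cong₂ (λ x y → (σ ⊞ σ′) ++ x ∷ y ∷ τ ⊞ τ′) (+-comm c e) (+-comm d e′))
             (sym (⊞-++ σ σ′ {e ∷ e′ ∷ τ} {c ∷ d ∷ τ′} (sym σ′≡)))))
           (D-cong c d λ e e′ → cong φ (trans (sym (⊞-++ σ σ′ (sym σ′≡)))
             (cong (_⊞ (σ′ ++ e ∷ e′ ∷ τ′)) (sym (swapAt-++ σ a b τ))))) ⟩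
    D a b (λ e e′ → φ ((σ ++ e ∷ e′ ∷ τ) ⊞ (σ′ ++ c ∷ d ∷ τ′))) +ᶻ
    D c d (λ e e′ → φ (swapAt n (σ ++ a ∷ b ∷ τ) ⊞ (σ′ ++ e ∷ e′ ∷ τ′)))
      ≡⟨ cong₂ _+ᶻ_
           (δ-split σ a b τ (λ γ → φ (γ ⊞ (σ′ ++ c ∷ d ∷ τ′))))
           (δ-split σ′ c d τ′ (λ γ → φ (swapAt n (σ ++ a ∷ b ∷ τ) ⊞ γ))) ⟨
    δ n (λ γ → φ (γ ⊞ (σ′ ++ c ∷ d ∷ τ′))) (σ ++ a ∷ b ∷ τ) +ᶻ
    δ (length σ′) (λ γ → φ (swapAt n (σ ++ a ∷ b ∷ τ) ⊞ γ)) (σ′ ++ c ∷ d ∷ τ′)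
      ≡⟨ cong (λ m → δ n (λ γ → φ (γ ⊞ (σ′ ++ c ∷ d ∷ τ′))) (σ ++ a ∷ b ∷ τ) +ᶻ
           δ m (λ γ → φ (swapAt n (σ ++ a ∷ b ∷ τ) ⊞ γ)) (σ′ ++ c ∷ d ∷ τ′)) σ′≡ ⟩
    δ n (λ γ → φ (γ ⊞ (σ′ ++ c ∷ d ∷ τ′))) (σ ++ a ∷ b ∷ τ) +ᶻ
    δ n (λ γ → φ (swapAt n (σ ++ a ∷ b ∷ τ) ⊞ γ)) (σ′ ++ c ∷ d ∷ τ′) ∎
    where
    n = length σ
    ψ : ℕ → ℕ → ℤ
    ψ e e′ = φ ((σ ⊞ σ′) ++ e ∷ e′ ∷ τ ⊞ τ′)

-- Schur polynomials

-- The pairs (ν , w) such that (k ∷ μ) / ν is a horizontal strip of size w,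
-- where ν has as many parts as μ.
below : ℕ → List ℕ → List (List ℕ × ℕ)
below k []      = [ [] , k ]
below k (m ∷ μ) = concatMap (λ j → map (λ (ν , w) → j ∷ ν , k ∸ j + w) (below m μ)) (range m k)

-- The monomials of s_κ(x₁,…,x_c) for κ with c parts, by branching on x_c.
schur : ℕ → List ℕ → List Exp
schur zero    _       = [ [] ]
schur (suc c) []      = []
schur (suc c) (k ∷ μ) = concatMap (λ (ν , w) → map (_∷ʳ w) (schur c ν)) (below k μ)

∑-below : ∀ k m μ (f : List ℕ × ℕ → ℤ) →
  ∑ (below k (m ∷ μ)) f ≡ ∑ (range m k) λ j → ∑ (below m μ) λ (ν , w) → f (j ∷ ν , k ∸ j + w)
∑-below k m μ f = trans (∑-concatMap (λ j → map _ (below m μ)) (range m k) f)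
  (∑-cong (range m k) λ j → ∑-map (λ (ν , w) → j ∷ ν , k ∸ j + w) (below m μ) f)

∑-schur : ∀ c k μ f →
  ∑ (schur (suc c) (k ∷ μ)) f ≡ ∑ (below k μ) λ (ν , w) → ∑ (schur c ν) λ σ → f (σ ∷ʳ w)
∑-schur c k μ f = trans (∑-concatMap (λ (ν , w) → map (_∷ʳ w) (schur c ν)) (below k μ) f)
  (∑-cong (below k μ) λ (ν , w) → ∑-map (_∷ʳ w) (schur c ν) f)

Parts≤ : ℕ → List ℕ → Set
Parts≤ k []      = ⊤
Parts≤ k (m ∷ μ) = m ≤ k × Parts≤ m μ

Parts≤-mono : ∀ {k l} μ → k ≤ l → Parts≤ k μ → Parts≤ l μ
Parts≤-mono []      k≤l _       = tt
Parts≤-mono (m ∷ μ) k≤l (p , q) = ≤-trans p k≤l , q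

-- Branching in the last two variables, and symmetry

Ψ : Set
Ψ = List ℕ → ℕ → ℕ → ℤ

-- Both functionals branch twice, with x and y the last two variables, and pair ψ
-- with the resulting sum of s_ρ x^v y^w: rows starts from s_(k,m,μ); slant branches
-- s_(m,μ) off y, puts the part k in front, and then branches off x.
slant : ℕ → ℕ → List ℕ → Ψ → ℤ
slant k m μ ψ = ∑ (below m μ) λ (ν , w) → ∑ (below k ν) λ (ρ , v) → ψ ρ v w

rows : ℕ → ℕ → List ℕ → Ψ → ℤ
rows k m μ ψ = ∑ (range m k) λ j → slant j m μ λ ρ v w → ψ ρ v (k ∸ j + w)

slant-cong : ∀ k m μ {ψ χ : Ψ} → (∀ ρ v w → ψ ρ v w ≡ χ ρ v w) → slant k m μ ψ ≡ slant k m μ χ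
slant-cong k m μ ψ≗χ = ∑-cong (below m μ) λ (ν , w) → ∑-cong (below k ν) λ (ρ , v) → ψ≗χ ρ v w

rows-cong : ∀ k m μ {ψ χ : Ψ} → (∀ ρ v w → ψ ρ v w ≡ χ ρ v w) → rows k m μ ψ ≡ rows k m μ χ
rows-cong k m μ ψ≗χ = ∑-cong (range m k) λ j → slant-cong j m μ λ ρ v w → ψ≗χ ρ v (k ∸ j + w)

slant-+ : ∀ k m μ (ψ χ : Ψ) →
  slant k m μ (λ ρ v w → ψ ρ v w +ᶻ χ ρ v w) ≡ slant k m μ ψ +ᶻ slant k m μ χ
slant-+ k m μ ψ χ = trans
  (∑-cong (below m μ) λ (ν , w) → ∑-distrib-+ (below k ν) (λ (ρ , v) → ψ ρ v w) (λ (ρ , v) → χ ρ v w))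
  (∑-distrib-+ (below m μ) _ _)

rows-+ : ∀ k m μ (ψ χ : Ψ) →
  rows k m μ (λ ρ v w → ψ ρ v w +ᶻ χ ρ v w) ≡ rows k m μ ψ +ᶻ rows k m μ χ
rows-+ k m μ ψ χ = trans
  (∑-cong (range m k) λ j → slant-+ j m μ (λ ρ v w → ψ ρ v (k ∸ j + w)) (λ ρ v w → χ ρ v (k ∸ j + w)))
  (∑-distrib-+ (range m k) _ _)

slant-∑ : ∀ k m μ (xs : List A) (ψ : A → Ψ) →
  slant k m μ (λ ρ v w → ∑ xs λ x → ψ x ρ v w) ≡ ∑ xs λ x → slant k m μ (ψ x)
slant-∑ k m μ xs ψ = trans
  (∑-cong (below m μ) λ (ν , w) → ∑-swap (below k ν) xs λ (ρ , v) x → ψ x ρ v w)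
  (∑-swap (below m μ) xs λ (ν , w) x → ∑ (below k ν) λ (ρ , v) → ψ x ρ v w)

rows-∑ : ∀ k m μ (xs : List A) (ψ : A → Ψ) →
  rows k m μ (λ ρ v w → ∑ xs λ x → ψ x ρ v w) ≡ ∑ xs λ x → rows k m μ (ψ x)
rows-∑ k m μ xs ψ = trans
  (∑-cong (range m k) λ j → slant-∑ j m μ xs λ x ρ v w → ψ x ρ v (k ∸ j + w))
  (∑-swap (range m k) xs λ j x → slant j m μ λ ρ v w → ψ x ρ v (k ∸ j + w))

-- For the first parts j of ν and r of ρ the conditions are m′ ≤ j ≤ m and j ≤ r ≤ k. With r
-- outermost, j is left with m′ ≤ j ≤ min(m, r), which makes the inner sum a `rows` of a shorter
-- partition; the strip size m - j splits at min(m, r).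
slant-∷ : ∀ k m m′ μ ψ → m ≤ k → slant k m (m′ ∷ μ) ψ ≡ ∑ (range m′ k) λ r →
  rows (m ⊓ r) m′ μ λ ρ v w → ψ (r ∷ ρ) (k ∸ r + v) (m ∸ m ⊓ r + w)
slant-∷ k m m′ μ ψ m≤k = begin
  slant k m (m′ ∷ μ) ψ
    ≡⟨ ∑-below m m′ μ _ ⟩
  ∑ (range m′ m) (λ j → ∑ (below m′ μ) λ (ν , w) → ∑ (below k (j ∷ ν)) λ (ρ , v) → ψ ρ v (m ∸ j + w))
    ≡⟨ ∑-cong (range m′ m) (λ j → ∑-cong (below m′ μ) λ (ν , w) → ∑-below k j ν _) ⟩
  ∑ (range m′ m) (λ j → ∑ (below m′ μ) λ (ν , w) → ∑ (range j k) λ r → ∑ (below j ν) λ (ρ , v) →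
    ψ (r ∷ ρ) (k ∸ r + v) (m ∸ j + w))
    ≡⟨ ∑-cong (range m′ m) (λ j → ∑-swap (below m′ μ) (range j k) λ (ν , w) r →
         ∑ (below j ν) λ (ρ , v) → ψ (r ∷ ρ) (k ∸ r + v) (m ∸ j + w)) ⟩
  ∑ (range m′ m) (λ j → ∑ (range j k) λ r → slant j m′ μ λ ρ v w → ψ (r ∷ ρ) (k ∸ r + v) (m ∸ j + w))
    ≡⟨ ∑-range-exchange (suc k) m′ m m′ k (λ j → j) (λ _ → k) (λ _ → m′) (m ⊓_)
         (λ j r → slant j m′ μ λ ρ v w → ψ (r ∷ ρ) (k ∸ r + v) (m ∸ j + w))
         (s≤s m≤k) ≤-refl (λ _ _ → ≤-refl) (λ r r≤k → s≤s (≤-trans (m⊓n≤n m r) r≤k))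
         (λ j r (p , q) (p′ , q′) → (≤-trans p p′ , q′) , (p , ⊓-glb q p′))
         (λ j r (p , q) (p′ , q′) → (p′ , m≤n⊓o⇒m≤n m r q′) , (m≤n⊓o⇒m≤o m r q′ , q)) ⟩
  ∑ (range m′ k) (λ r → ∑ (range m′ (m ⊓ r)) λ j → slant j m′ μ λ ρ v w →
    ψ (r ∷ ρ) (k ∸ r + v) (m ∸ j + w))
    ≡⟨ ∑-cong (range m′ k) (λ r → ∑-range-cong m′ (m ⊓ r) λ j _ j≤ → slant-cong j m′ μ λ ρ v w →
         cong (ψ (r ∷ ρ) (k ∸ r + v)) (regroup j r w j≤)) ⟩
  ∑ (range m′ k) (λ r → rows (m ⊓ r) m′ μ λ ρ v w → ψ (r ∷ ρ) (k ∸ r + v) (m ∸ m ⊓ r + w)) ∎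
  where
  regroup : ∀ j r w → j ≤ m ⊓ r → m ∸ j + w ≡ m ∸ m ⊓ r + (m ⊓ r ∸ j + w)
  regroup j r w j≤ = begin
    m ∸ j + w                          ≡⟨ cong (λ x → x ∸ j + w) (m∸n+n≡m (m⊓n≤m m r)) ⟨
    m ∸ m ⊓ r + m ⊓ r ∸ j + w          ≡⟨ cong (_+ w) (+-∸-assoc (m ∸ m ⊓ r) j≤) ⟩
    m ∸ m ⊓ r + (m ⊓ r ∸ j) + w        ≡⟨ +-assoc (m ∸ m ⊓ r) _ w ⟩
    m ∸ m ⊓ r + (m ⊓ r ∸ j + w)        ∎

-- Joint induction with `rows-∂`. For a fixed first part r of ρ, `slant-∷` leaves the monomial
-- x^(k-r) y^(m-min(m,r)) times a `rows` of a shorter partition. That factor is symmetric by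
-- `rows-∂`, so π acts on the monomial alone, where `D-string` computes it.
slant-π : ∀ k m μ ψ → m ≤ k → Parts≤ m μ →
  slant k m μ (λ ρ v w → D (suc v) w (ψ ρ)) ≡ rows k m μ ψ

-- Symmetry in x and y: by `slant-π` the sum lies in the image of π, and ∂π = ∂∂x vanishes by `D∘D`.
-- The call to `slant-π` keeps `μ`, and `slant-π` calls back at a shorter one.
rows-∂ : ∀ k m μ ψ → m ≤ k → Parts≤ m μ →
  rows k m μ (λ ρ v w → D v w (ψ ρ)) ≡ 0ℤ
rows-∂ k m μ ψ m≤k parts = begin
  rows k m μ (λ ρ v w → D v w (ψ ρ))
    ≡⟨ slant-π k m μ (λ ρ v w → D v w (ψ ρ)) m≤k parts ⟨
  slant k m μ (λ ρ v w → D (suc v) w (λ e e′ → D e e′ (ψ ρ)))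
    ≡⟨ ∑-zero (below m μ) (λ (ν , w) _ → ∑-zero (below k ν) λ (ρ , v) _ → D∘D (suc v) w (ψ ρ)) ⟩
  0ℤ ∎

slant-π k m []       ψ m≤k parts = begin
  D (suc k) m (ψ []) +ᶻ 0ℤ +ᶻ 0ℤ
    ≡⟨ trans (ℤₚ.+-identityʳ _) (ℤₚ.+-identityʳ _) ⟩
  D (suc k) m (ψ [])
    ≡⟨ D-string (ψ []) m≤k ⟩
  ∑ (range m k) (λ j → ψ [] j (k ∸ j + m))
    ≡⟨ ∑-cong (range m k) (λ j → trans (ℤₚ.+-identityʳ _) (ℤₚ.+-identityʳ _)) ⟨
  rows k m [] ψ ∎
slant-π k m (m′ ∷ μ) ψ m≤k (m′≤m , parts) = begin
  slant k m (m′ ∷ μ) (λ ρ v w → D (suc v) w (ψ ρ))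
    ≡⟨ slant-∷ k m m′ μ _ m≤k ⟩
  ∑ (range m′ k) (λ r → rows (m ⊓ r) m′ μ λ ρ v w →
    D (suc (k ∸ r + v)) (m ∸ m ⊓ r + w) (ψ (r ∷ ρ)))
    ≡⟨ ∑-range-cong m′ k (λ r m′≤r r≤k → symmetrise r m′≤r r≤k) ⟩
  ∑ (range m′ k) (λ r → ∑ (range (m ⊔ r) k) λ j → F j r)
    ≡⟨ ∑-range-exchange (suc k) m k m′ k (λ _ → m′) (λ j → j) (m ⊔_) (λ _ → k) F
         ≤-refl ≤-refl (λ _ j≤k → s≤s j≤k) (λ _ _ → ≤-refl)
         (λ j r (p , q) (p′ , q′) → (p′ , ≤-trans q′ q) , (⊔-lub p q′ , q))
         (λ j r (p , q) (p′ , q′) → (m⊔n≤o⇒m≤o m r p′ , q′) , (p , m⊔n≤o⇒n≤o m r p′)) ⟨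
  ∑ (range m k) (λ j → ∑ (range m′ j) λ r → F j r)
    ≡⟨ ∑-range-cong m k (λ j m≤j _ → slant-∷ j m m′ μ (λ ρ v w → ψ ρ v (k ∸ j + w)) m≤j) ⟨
  rows k m (m′ ∷ μ) ψ ∎
  where
  F : ℕ → ℕ → ℤ
  F j r = rows (m ⊓ r) m′ μ λ ρ v w → ψ (r ∷ ρ) (j ∸ r + v) (k ∸ j + (m ∸ m ⊓ r + w))

  r+[m∸m⊓r] : ∀ r → r + (m ∸ m ⊓ r) ≡ m ⊔ r
  r+[m∸m⊓r] r with ≤-total m r
  ... | inj₁ m≤r rewrite m≤n⇒m⊓n≡m m≤r | n∸n≡0 m | m≤n⇒m⊔n≡n m≤r = +-identityʳ r
  ... | inj₂ r≤m rewrite m≥n⇒m⊓n≡n r≤m | m≥n⇒m⊔n≡m r≤m = m+[n∸m]≡n r≤m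

  symmetrise : ∀ r → m′ ≤ r → r ≤ k →
    rows (m ⊓ r) m′ μ (λ ρ v w → D (suc (k ∸ r + v)) (m ∸ m ⊓ r + w) (ψ (r ∷ ρ))) ≡
    ∑ (range (m ⊔ r) k) λ j → F j r
  symmetrise r m′≤r r≤k = begin
    rows t m′ μ (λ ρ v w → D (suc p + v) (q + w) (ψ (r ∷ ρ)))
      ≡⟨ rows-cong t m′ μ (λ ρ v w → D-leibniz (suc p) q v w (ψ (r ∷ ρ))) ⟩
    rows t m′ μ (λ ρ v w → D (suc p) q (λ e e′ → ψ (r ∷ ρ) (v + e) (w + e′)) +ᶻ
                            D v w (λ e e′ → ψ (r ∷ ρ) (q + e) (suc p + e′)))
      ≡⟨ rows-+ t m′ μ (λ ρ v w → D (suc p) q (λ e e′ → ψ (r ∷ ρ) (v + e) (w + e′)))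
           (λ ρ v w → D v w (λ e e′ → ψ (r ∷ ρ) (q + e) (suc p + e′))) ⟩
    rows t m′ μ (λ ρ v w → D (suc p) q (λ e e′ → ψ (r ∷ ρ) (v + e) (w + e′))) +ᶻ
    rows t m′ μ (λ ρ v w → D v w (λ e e′ → ψ (r ∷ ρ) (q + e) (suc p + e′)))
      ≡⟨ cong₂ _+ᶻ_
           (rows-cong t m′ μ λ ρ v w → D-string (λ e e′ → ψ (r ∷ ρ) (v + e) (w + e′)) q≤p)
           (rows-∂ t m′ μ (λ ρ e e′ → ψ (r ∷ ρ) (q + e) (suc p + e′)) (⊓-glb m′≤m m′≤r) parts) ⟩
    rows t m′ μ (λ ρ v w → ∑ (range q p) λ i → ψ (r ∷ ρ) (v + i) (w + (p ∸ i + q))) +ᶻ 0ℤ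
      ≡⟨ ℤₚ.+-identityʳ _ ⟩
    rows t m′ μ (λ ρ v w → ∑ (range q p) λ i → ψ (r ∷ ρ) (v + i) (w + (p ∸ i + q)))
      ≡⟨ rows-∑ t m′ μ (range q p) (λ i ρ v w → ψ (r ∷ ρ) (v + i) (w + (p ∸ i + q))) ⟩
    ∑ (range q p) (λ i → rows t m′ μ λ ρ v w → ψ (r ∷ ρ) (v + i) (w + (p ∸ i + q)))
      -- The exponent i of x in the string becomes j = r + i, which runs from r + q = max(m, r) to r
      -- + p = k.
      ≡⟨ ∑-cong (range q p) (λ i → rows-cong t m′ μ λ ρ v w → cong₂ (ψ (r ∷ ρ))
           (trans (+-comm v i) (cong (_+ v) (sym (m+n∸m≡n r i))))
           (trans (eq w (p ∸ i) q) (cong (_+ (q + w)) (∸-+-assoc k r i)))) ⟩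
    ∑ (range q p) (λ i → F (r + i) r)
      ≡⟨ ∑-range-shift r q p (λ j → F j r) ⟨
    ∑ (range (r + q) (r + p)) (λ j → F j r)
      ≡⟨ cong₂ (λ x y → ∑ (range x y) λ j → F j r) (r+[m∸m⊓r] r) (m+[n∸m]≡n r≤k) ⟩
    ∑ (range (m ⊔ r) k) (λ j → F j r) ∎
    where
    t = m ⊓ r
    p = k ∸ r
    q = m ∸ m ⊓ r
    q≤p : q ≤ p
    q≤p = +-cancelˡ-≤ r q p (subst₂ _≤_ (sym (r+[m∸m⊓r] r)) (sym (m+[n∸m]≡n r≤k)) (⊔-lub m≤k r≤k))
    eq : ∀ w x q → w + (x + q) ≡ x + (q + w)
    eq = ℕ-Solver.solve-∀

length-schur : ∀ c κ {σ} → σ ∈ schur c κ → length σ ≡ c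
length-schur zero    κ       (here refl) = refl
length-schur (suc c) (k ∷ μ) σ∈
  with (ν , w) , _ , σ∈′ ← find (∈-concatMap⁻ (λ (ν , w) → map (_∷ʳ w) (schur c ν)) {xs = below k μ} σ∈)
  with σ′ , σ′∈ , refl ← ∈-map⁻ (_∷ʳ w) σ∈′ =
  trans (length-++ σ′) (trans (+-comm (length σ′) 1) (cong suc (length-schur c ν σ′∈)))

below-parts : ∀ k μ {ν w} → Parts≤ k μ → (ν , w) ∈ below k μ → length ν ≡ length μ × Parts≤ k ν
below-parts k []      _ (here refl) = refl , tt
below-parts k (m ∷ μ) (m≤k , parts) ν∈
  with j , j∈ , ν∈′ ← find (∈-concatMap⁻ (λ j → map (λ (ν , w) → j ∷ ν , k ∸ j + w) (below m μ)) {xs = range m k} ν∈)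
  with (ν′ , w′) , ν′∈ , refl ← ∈-map⁻ (λ (ν , w) → j ∷ ν , k ∸ j + w) ν∈′
  with m≤j , j≤k ← ∈-range⁻ j∈
  with len , parts′ ← below-parts m μ parts ν′∈ =
  cong suc len , j≤k , Parts≤-mono ν′ m≤j parts′

∷ʳ-∷ʳ : ∀ (σ : Exp) v w → σ ∷ʳ v ∷ʳ w ≡ σ ++ v ∷ w ∷ []
∷ʳ-∷ʳ σ v w = ++-assoc σ [ v ] [ w ]

∑-schur-rows : ∀ c k m μ φ → ∑ (schur (2 + c) (k ∷ m ∷ μ)) φ ≡
  rows k m μ λ ρ v w → ∑ (schur c ρ) λ σ → φ (σ ++ v ∷ w ∷ [])
∑-schur-rows c k m μ φ = begin
  ∑ (schur (2 + c) (k ∷ m ∷ μ)) φ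
    ≡⟨ ∑-schur (suc c) k (m ∷ μ) φ ⟩
  ∑ (below k (m ∷ μ)) (λ (ν , w) → ∑ (schur (suc c) ν) λ σ → φ (σ ∷ʳ w))
    ≡⟨ ∑-below k m μ _ ⟩
  ∑ (range m k) (λ j → ∑ (below m μ) λ (ν , w) → ∑ (schur (suc c) (j ∷ ν)) λ σ → φ (σ ∷ʳ (k ∸ j + w)))
    ≡⟨ ∑-cong (range m k) (λ j → ∑-cong (below m μ) λ (ν , w) → trans
         (∑-schur c j ν _)
         (∑-cong (below j ν) λ (ρ , v) → ∑-cong (schur c ρ) λ σ → cong φ (∷ʳ-∷ʳ σ v _))) ⟩
  rows k m μ (λ ρ v w → ∑ (schur c ρ) λ σ → φ (σ ++ v ∷ w ∷ [])) ∎

∑-δ-last : ∀ c κ a b φ →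
  ∑ (schur c κ) (λ σ → δ c φ (σ ++ a ∷ b ∷ [])) ≡
  D a b λ e e′ → ∑ (schur c κ) λ σ → φ (σ ++ e ∷ e′ ∷ [])
∑-δ-last c κ a b φ = trans
  (∑-cong-∈ (schur c κ) λ σ σ∈ → trans
    (cong (λ i → δ i φ (σ ++ a ∷ b ∷ [])) (sym (length-schur c κ σ∈)))
    (δ-split σ a b [] φ))
  (sym (D-∑ a b (schur c κ) λ σ e e′ → φ (σ ++ e ∷ e′ ∷ [])))

schur-symmetric-last : ∀ c k μ φ → length μ ≡ suc c → Parts≤ k μ → ∑ (schur (2 + c) (k ∷ μ)) (δ c φ) ≡ 0ℤ
schur-symmetric-last c k (m ∷ μ) φ len (m≤k , parts) = begin
  ∑ (schur (2 + c) (k ∷ m ∷ μ)) (δ c φ)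
    ≡⟨ ∑-schur-rows c k m μ (δ c φ) ⟩
  rows k m μ (λ ρ v w → ∑ (schur c ρ) λ σ → δ c φ (σ ++ v ∷ w ∷ []))
    ≡⟨ rows-cong k m μ (λ ρ v w → ∑-δ-last c ρ v w φ) ⟩
  rows k m μ (λ ρ v w → D v w λ e e′ → ∑ (schur c ρ) λ σ → φ (σ ++ e ∷ e′ ∷ []))
    ≡⟨ rows-∂ k m μ (λ ρ e e′ → ∑ (schur c ρ) λ σ → φ (σ ++ e ∷ e′ ∷ [])) m≤k parts ⟩
  0ℤ ∎

-- Annihilation by ∂_i expresses symmetry in x_i and x_(i+1). An earlier pair is untouched by
-- branching off the last variable, so only the last pair calls for `rows-∂`.
schur-symmetric : ∀ K c κ i φ → length κ ≡ c → Parts≤ K κ → 2 + i ≤ c → ∑ (schur c κ) (δ i φ) ≡ 0ℤ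
schur-symmetric K (suc c) (k ∷ μ) i φ len (_ , parts) (s≤s i<c) with m≤n⇒m<n∨m≡n i<c
... | inj₂ refl = schur-symmetric-last i k μ φ (suc-injective len) parts
... | inj₁ 1+i<c = begin
  ∑ (schur (suc c) (k ∷ μ)) (δ i φ)
    ≡⟨ ∑-schur c k μ (δ i φ) ⟩
  ∑ (below k μ) (λ (ν , w) → ∑ (schur c ν) λ σ → δ i φ (σ ∷ʳ w))
    ≡⟨ ∑-zero (below k μ) (λ (ν , w) ν∈ → let len′ , parts′ = below-parts k μ parts ν∈ in trans
         (∑-cong-∈ (schur c ν) λ σ σ∈ →
           δ-++ˡ i σ [ w ] φ (subst (2 + i ≤_) (sym (length-schur c ν σ∈)) 1+i<c))
         (schur-symmetric k c ν i (λ γ → φ (γ ∷ʳ w)) (trans len′ (suc-injective len)) parts′ 1+i<c)) ⟩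
  0ℤ ∎

-- Isobaric divided differences

increment : ℕ → Exp → Exp
increment i α = set α i (suc (at α i))

increment-split : ∀ σ a τ → increment (length σ) (σ ++ a ∷ τ) ≡ σ ++ suc a ∷ τ
increment-split σ a τ = trans (cong (set (σ ++ a ∷ τ) (length σ) ∘ suc) (at-++ σ a τ)) (set-++ σ a τ (suc a))

-- The dual of the isobaric divided difference f ↦ ∂ᵢ (xᵢ f).
π : ℕ → (Exp → ℤ) → Exp → ℤ
π i φ α = δ i φ (increment i α)

π-split : ∀ σ a b τ φ → π (length σ) φ (σ ++ a ∷ b ∷ τ) ≡ D (suc a) b (λ e e′ → φ (σ ++ e ∷ e′ ∷ τ))
π-split σ a b τ φ = trans (cong (δ (length σ) φ) (increment-split σ a (b ∷ τ))) (δ-split σ (suc a) b τ φ)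

π-cong : ∀ i α {φ χ} → 2 + i ≤ length α → (∀ γ → length γ ≡ length α → φ γ ≡ χ γ) → π i φ α ≡ π i χ α
π-cong i α i< φ≗χ = δ-cong i (increment i α) (subst (2 + i ≤_) (sym len) i<)
  λ γ γ≡ → φ≗χ γ (trans γ≡ len)
  where
  len : length (increment i α) ≡ length α
  len = length-set α i _

π-++ˡ : ∀ i σ τ φ → 2 + i ≤ length σ → π i φ (σ ++ τ) ≡ π i (λ γ → φ (γ ++ τ)) σ
π-++ˡ i σ τ φ i< with splitAt i σ i<
... | split ρ a b υ = begin
  π (length ρ) φ ((ρ ++ a ∷ b ∷ υ) ++ τ)
    ≡⟨ cong (π (length ρ) φ) (++-assoc ρ (a ∷ b ∷ υ) τ) ⟩
  π (length ρ) φ (ρ ++ a ∷ b ∷ υ ++ τ)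
    ≡⟨ π-split ρ a b (υ ++ τ) φ ⟩
  D (suc a) b (λ e e′ → φ (ρ ++ e ∷ e′ ∷ υ ++ τ))
    ≡⟨ D-cong (suc a) b (λ e e′ → cong φ (++-assoc ρ (e ∷ e′ ∷ υ) τ)) ⟨
  D (suc a) b (λ e e′ → φ ((ρ ++ e ∷ e′ ∷ υ) ++ τ))
    ≡⟨ π-split ρ a b υ (λ γ → φ (γ ++ τ)) ⟨
  π (length ρ) (λ γ → φ (γ ++ τ)) (ρ ++ a ∷ b ∷ υ) ∎

π* : ℕ → (Exp → ℤ) → Exp → ℤ
π* zero    φ = φ
π* (suc c) φ = π* c (π c φ)

π*-cong : ∀ c α {φ χ} → suc c ≤ length α → (∀ γ → length γ ≡ length α → φ γ ≡ χ γ) → π* c φ α ≡ π* c χ α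
π*-cong zero    α c< φ≗χ = φ≗χ α refl
π*-cong (suc c) α c< φ≗χ = π*-cong c α (<⇒≤ c<) λ γ γ≡ →
  π-cong c γ (subst (2 + c ≤_) (sym γ≡) c<) λ γ′ γ′≡ → φ≗χ γ′ (trans γ′≡ γ≡)

π*-++ˡ : ∀ c σ τ φ → suc c ≤ length σ → π* c φ (σ ++ τ) ≡ π* c (λ γ → φ (γ ++ τ)) σ
π*-++ˡ zero    σ τ φ c< = refl
π*-++ˡ (suc c) σ τ φ c< = trans (π*-++ˡ c σ τ (π c φ) (<⇒≤ c<))
  (π*-cong c σ (<⇒≤ c<) λ γ γ≡ → π-++ˡ c γ τ φ (subst (2 + c ≤_) (sym γ≡) c<))

-- π_{c-1} ⋯ π_0 (x_0^k s_μ(x_1,…,x_c)) = s_{(k,μ)}(x_0,…,x_c).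
π*-schur : ∀ c k μ φ → length μ ≡ c → Parts≤ k μ →
  ∑ (schur c μ) (λ σ → π* c φ (k ∷ σ)) ≡ ∑ (schur (suc c) (k ∷ μ)) φ
π*-schur zero    k []      φ len parts = refl
π*-schur (suc c) k (m ∷ μ) φ len (m≤k , parts) = begin
  ∑ (schur (suc c) (m ∷ μ)) (λ σ → π* c (π c φ) (k ∷ σ))
    ≡⟨ ∑-schur c m μ _ ⟩
  ∑ (below m μ) (λ (ν , w) → ∑ (schur c ν) λ σ → π* c (π c φ) (k ∷ σ ∷ʳ w))
    -- The operators π_0, ..., π_(c-1) do not touch the last variable, so by induction they put the
    -- part `k` in front of each `ν`. Only π_c remains, acting on the last two variables.
    ≡⟨ ∑-cong-∈ (below m μ) (λ (ν , w) ν∈ → let len′ , parts′ = below-parts m μ parts ν∈ in trans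
         (∑-cong-∈ (schur c ν) λ σ σ∈ → π*-++ˡ c (k ∷ σ) [ w ] (π c φ)
           (s≤s (≤-reflexive (sym (length-schur c ν σ∈)))))
         (trans
         (π*-schur c k ν (λ γ → π c φ (γ ∷ʳ w)) (trans len′ (suc-injective len)) (Parts≤-mono ν m≤k parts′))
         (∑-schur c k ν (λ γ → π c φ (γ ∷ʳ w))))) ⟩
  slant k m μ (λ ρ v w → ∑ (schur c ρ) λ σ → π c φ (σ ∷ʳ v ∷ʳ w))
    ≡⟨ slant-cong k m μ (λ ρ v w → ∑-π-last ρ v w) ⟩
  slant k m μ (λ ρ v w → D (suc v) w λ e e′ → ∑ (schur c ρ) λ σ → φ (σ ++ e ∷ e′ ∷ []))
    ≡⟨ slant-π k m μ (λ ρ e e′ → ∑ (schur c ρ) λ σ → φ (σ ++ e ∷ e′ ∷ [])) m≤k parts ⟩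
  rows k m μ (λ ρ v w → ∑ (schur c ρ) λ σ → φ (σ ++ v ∷ w ∷ []))
    ≡⟨ ∑-schur-rows c k m μ φ ⟨
  ∑ (schur (2 + c) (k ∷ m ∷ μ)) φ ∎
  where
  ∑-π-last : ∀ ρ v w → ∑ (schur c ρ) (λ σ → π c φ (σ ∷ʳ v ∷ʳ w)) ≡
    D (suc v) w λ e e′ → ∑ (schur c ρ) λ σ → φ (σ ++ e ∷ e′ ∷ [])
  ∑-π-last ρ v w = trans
    (∑-cong-∈ (schur c ρ) λ σ σ∈ → begin
      π c φ (σ ∷ʳ v ∷ʳ w)               ≡⟨ cong (π c φ) (∷ʳ-∷ʳ σ v w) ⟩
      π c φ (σ ++ v ∷ w ∷ [])           ≡⟨ cong (λ i → π i φ (σ ++ v ∷ w ∷ [])) (length-schur c ρ σ∈) ⟨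
      π (length σ) φ (σ ++ v ∷ w ∷ [])  ≡⟨ cong (δ (length σ) φ) (increment-split σ v (w ∷ [])) ⟩
      δ (length σ) φ (σ ++ suc v ∷ w ∷ []) ≡⟨ cong (λ i → δ i φ (σ ++ suc v ∷ w ∷ [])) (length-schur c ρ σ∈) ⟩
      δ c φ (σ ++ suc v ∷ w ∷ [])       ∎)
    (∑-δ-last c ρ (suc v) w φ)

-- Staircases and the expansion of Q

stair : ℕ → ℕ → Exp
stair q zero    = []
stair q (suc c) = q + c ∷ stair q c

-- The offset `q` serves this identity: dropping the last step of a staircase leaves one whose
-- lowest step is one higher.
stair-∷ʳ : ∀ q c → stair q (suc c) ≡ stair (suc q) c ∷ʳ q
stair-∷ʳ q zero    = cong [_] (+-identityʳ q)
stair-∷ʳ q (suc c) = cong₂ _∷_ (+-suc q c) (stair-∷ʳ q c)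

stair-++ : ∀ q c r → stair q (suc c) ++ r ≡ stair (suc q) c ++ q ∷ r
stair-++ q c r = trans (cong (_++ r) (stair-∷ʳ q c)) (++-assoc (stair (suc q) c) [ q ] r)

length-stair : ∀ q c → length (stair q c) ≡ c
length-stair q zero    = refl
length-stair q (suc c) = cong suc (length-stair q c)

stair-0 : ∀ c → stair 0 c ≡ downFrom c
stair-0 zero    = refl
stair-0 (suc c) = cong (c ∷_) (stair-0 c)

-- ∂ᵢ (x^p xᵢ^(q+1) xᵢ₊₁^q x^r · f) = x^p xᵢ^q xᵢ₊₁^q x^r · πᵢ f.
δ-descent : ∀ i p q r γ φ → length p ≡ i → length γ ≡ length (p ++ q ∷ q ∷ r) →
  δ i φ ((p ++ suc q ∷ q ∷ r) ⊞ γ) ≡ π i (λ γ → φ ((p ++ q ∷ q ∷ r) ⊞ γ)) γ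
δ-descent i p q r γ φ p≡ γ≡ with splitAt i γ (subst (2 + i ≤_) (sym γ≡) 2+i≤)
  where
  2+i≤ : 2 + i ≤ length (p ++ q ∷ q ∷ r)
  2+i≤ = subst₂ _≤_ (trans (+-comm (length p) 2) (cong (2 +_) p≡)) (sym (length-++ p))
    (+-monoʳ-≤ (length p) (s≤s (s≤s z≤n)))
... | split σ a b τ = begin
  δ (length σ) φ ((p ++ suc q ∷ q ∷ r) ⊞ (σ ++ a ∷ b ∷ τ))
    ≡⟨ cong₂ (λ x y → δ x φ y) (sym (trans (length-⊞ p σ p≡) p≡)) (⊞-++ p σ p≡) ⟩
  δ (length (p ⊞ σ)) φ ((p ⊞ σ) ++ suc q + a ∷ q + b ∷ r ⊞ τ)
    ≡⟨ δ-split (p ⊞ σ) (suc q + a) (q + b) (r ⊞ τ) φ ⟩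
  D (suc q + a) (q + b) ψ
    ≡⟨ cong (λ x → D x (q + b) ψ) (+-suc q a) ⟨
  D (q + suc a) (q + b) ψ
    ≡⟨ D-shift q (suc a) b ψ ⟩
  D (suc a) b (λ e e′ → φ ((p ⊞ σ) ++ q + e ∷ q + e′ ∷ r ⊞ τ))
    ≡⟨ D-cong (suc a) b (λ e e′ → cong φ (sym (⊞-++ p σ {q ∷ q ∷ r} {e ∷ e′ ∷ τ} p≡))) ⟩
  D (suc a) b (λ e e′ → φ ((p ++ q ∷ q ∷ r) ⊞ (σ ++ e ∷ e′ ∷ τ)))
    ≡⟨ π-split σ a b τ (λ γ → φ ((p ++ q ∷ q ∷ r) ⊞ γ)) ⟨
  π (length σ) (λ γ → φ ((p ++ q ∷ q ∷ r) ⊞ γ)) (σ ++ a ∷ b ∷ τ) ∎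
  where
  ψ : ℕ → ℕ → ℤ
  ψ e e′ = φ ((p ⊞ σ) ++ e ∷ e′ ∷ r ⊞ τ)

-- The operators work from left to right; each meets two neighbouring exponents differing by one and
-- levels them by `δ-descent`, acting as π_i on the other factor. The induction peels off the
-- rightmost operator and moves the lowest step into the tail `r`.
δ*-stair : ∀ c q r α φ → length α ≡ suc c + length r →
  δ* (downFrom c) φ ((stair q (suc c) ++ r) ⊞ α) ≡ π* c (λ γ → φ ((stair q c ++ q ∷ r) ⊞ γ)) α
δ*-stair zero    q r α φ α≡ = cong (λ x → φ ((x ∷ r) ⊞ α)) (+-identityʳ q)
δ*-stair (suc c) q r α φ α≡ = begin
  δ* (downFrom c) (δ c φ) ((stair q (2 + c) ++ r) ⊞ α)
    ≡⟨ cong (λ β → δ* (downFrom c) (δ c φ) (β ⊞ α)) (stair-++ q (suc c) r) ⟩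
  δ* (downFrom c) (δ c φ) ((stair (suc q) (suc c) ++ q ∷ r) ⊞ α)
    ≡⟨ δ*-stair c (suc q) (q ∷ r) α (δ c φ) (trans α≡ (sym (+-suc (suc c) (length r)))) ⟩
  π* c (λ γ → δ c φ ((stair (suc q) c ++ suc q ∷ q ∷ r) ⊞ γ)) α
    ≡⟨ π*-cong c α (subst (suc c ≤_) (sym α≡) (m≤n⇒m≤1+n (m≤m+n (suc c) (length r)))) (λ γ γ≡ →
         δ-descent c (stair (suc q) c) q r γ φ (length-stair (suc q) c) (trans γ≡ (trans α≡ len))) ⟩
  π* c (π c (λ γ → φ ((stair (suc q) c ++ q ∷ q ∷ r) ⊞ γ))) α
    ≡⟨ cong (λ β → π* c (π c (λ γ → φ (β ⊞ γ))) α) (stair-++ q c (q ∷ r)) ⟨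
  π* c (π c (λ γ → φ ((stair q (suc c) ++ q ∷ r) ⊞ γ))) α ∎
  where
  len : 2 + c + length r ≡ length (stair (suc q) c ++ q ∷ q ∷ r)
  len = sym (trans (length-++ (stair (suc q) c)) (trans (cong (_+ (2 + length r)) (length-stair (suc q) c))
    (trans (+-suc c (suc (length r))) (cong suc (+-suc c (length r))))))

downFrom-< : ∀ c → All (_< c) (downFrom c)
downFrom-< zero    = []
downFrom-< (suc c) = ≤-refl ∷ All.map m<n⇒m<1+n (downFrom-< c)

-- The positions exchanged while `b` entries in turn move left across `c` others, arriving at
-- positions j, j + 1, ....
mergeWord : ℕ → ℕ → ℕ → List ℕ
mergeWord j c zero    = []
mergeWord j c (suc b) = map (j +_) (downFrom c) ++ mergeWord (suc j) c b

-- The pairs (μ , β) for which s_μ(x₁,…,x_c) x^β, with β the exponents of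
-- x_{c+1},…,x_{c+k}, occurs in the Schubert polynomial of 1^c ⊕ w₀(k).
strips : ℕ → ℕ → List (List ℕ × Exp)
strips c zero    = [ replicate c 0 , [] ]
strips c (suc k) = concatMap (λ (μ , β) → map (λ (ν , w) → ν , w ∷ β) (below k μ)) (strips c k)

∑-strips : ∀ c k (f : List ℕ × Exp → ℤ) →
  ∑ (strips c (suc k)) f ≡ ∑ (strips c k) λ (μ , β) → ∑ (below k μ) λ (ν , w) → f (ν , w ∷ β)
∑-strips c k f = trans (∑-concatMap _ (strips c k) f)
  (∑-cong (strips c k) λ (μ , β) → ∑-map (λ (ν , w) → ν , w ∷ β) (below k μ) f)

strips-parts : ∀ c k {μ β} → (μ , β) ∈ strips c k → length μ ≡ c × Parts≤ k μ × length β ≡ k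
strips-parts c zero    (here refl) = length-replicate c , zeros 0 c , refl
  where
  zeros : ∀ k c → Parts≤ k (replicate c 0)
  zeros k zero    = tt
  zeros k (suc c) = z≤n , zeros 0 c
strips-parts c (suc k) ∈′
  with (μ , β) , μ∈ , ∈″ ← find (∈-concatMap⁻ (λ (μ , β) → map (λ (ν , w) → ν , w ∷ β) (below k μ)) {xs = strips c k} ∈′)
  with (ν , w) , ν∈ , refl ← ∈-map⁻ (λ (ν , w) → ν , w ∷ β) ∈″
  with len , parts , len′ ← strips-parts c k μ∈
  with len″ , parts′ ← below-parts k μ parts ν∈ =
  trans len″ len , Parts≤-mono ν (n≤1+n k) parts′ , cong suc len′

schur-zero : ∀ c → schur c (replicate c 0) ≡ [ replicate c 0 ]
schur-zero zero    = refl
schur-zero (suc c) = begin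
  concatMap (λ (ν , w) → map (_∷ʳ w) (schur c ν)) (below 0 (replicate c 0))
    ≡⟨ cong (concatMap (λ (ν , w) → map (_∷ʳ w) (schur c ν))) (below-zero c) ⟩
  map (_∷ʳ 0) (schur c (replicate c 0)) ++ []
    ≡⟨ ++-identityʳ _ ⟩
  map (_∷ʳ 0) (schur c (replicate c 0))
    ≡⟨ cong (map (_∷ʳ 0)) (schur-zero c) ⟩
  [ replicate c 0 ∷ʳ 0 ]
    ≡⟨ cong [_] (zeros-∷ʳ c) ⟩
  [ replicate (suc c) 0 ] ∎
  where
  zeros-∷ʳ : ∀ c → replicate c 0 ∷ʳ 0 ≡ replicate (suc c) 0
  zeros-∷ʳ zero    = refl
  zeros-∷ʳ (suc c) = cong (0 ∷_) (zeros-∷ʳ c)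
  below-zero : ∀ c → below 0 (replicate c 0) ≡ [ replicate c 0 , 0 ]
  below-zero zero    = refl
  below-zero (suc c) rewrite below-zero c = refl

-- The Schubert polynomial of w₀(c) ⊕ w₀(b) is x^(c-1,…,0) ∑ s_μ x^β over strips.
δ*-mergeWord : ∀ c b p φ → δ* (mergeWord (length p) c b) φ (p ++ downFrom (b + c)) ≡
  ∑ (strips c b) λ (μ , β) → ∑ (schur c μ) λ σ → φ (p ++ (downFrom c ⊞ σ) ++ β)
δ*-mergeWord c zero p φ = sym (begin
  ∑ (schur c (replicate c 0)) (λ σ → φ (p ++ (downFrom c ⊞ σ) ++ [])) +ᶻ 0ℤ
    ≡⟨ ℤₚ.+-identityʳ _ ⟩
  ∑ (schur c (replicate c 0)) (λ σ → φ (p ++ (downFrom c ⊞ σ) ++ []))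
    ≡⟨ cong (λ xs → ∑ xs (λ σ → φ (p ++ (downFrom c ⊞ σ) ++ []))) (schur-zero c) ⟩
  φ (p ++ (downFrom c ⊞ replicate c 0) ++ []) +ᶻ 0ℤ
    ≡⟨ ℤₚ.+-identityʳ _ ⟩
  φ (p ++ (downFrom c ⊞ replicate c 0) ++ [])
    ≡⟨ cong (λ α → φ (p ++ α)) (trans (++-identityʳ _) (trans
         (cong (λ n → downFrom c ⊞ replicate n 0) (sym (length-downFrom c))) (⊞-zeroʳ (downFrom c)))) ⟩
  φ (p ++ downFrom c) ∎)
δ*-mergeWord c (suc b) p φ = begin
  δ* (map (length p +_) (downFrom c) ++ mergeWord (suc (length p)) c b) φ (p ++ b + c ∷ downFrom (b + c))
    ≡⟨ δ*-++ (map (length p +_) (downFrom c)) (mergeWord (suc (length p)) c b) φ _ ⟩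
  δ* (mergeWord (suc (length p)) c b) φ₁ (p ++ b + c ∷ downFrom (b + c))
    ≡⟨ cong₂ (λ j α → δ* (mergeWord j c b) φ₁ α)
         (trans (+-comm 1 (length p)) (sym (length-++ p)))
         (sym (++-assoc p [ b + c ] (downFrom (b + c)))) ⟩
  δ* (mergeWord (length (p ∷ʳ (b + c))) c b) φ₁ ((p ∷ʳ (b + c)) ++ downFrom (b + c))
    ≡⟨ δ*-mergeWord c b (p ∷ʳ (b + c)) φ₁ ⟩
  ∑ (strips c b) (λ (μ , β) → ∑ (schur c μ) λ σ → φ₁ ((p ∷ʳ (b + c)) ++ (downFrom c ⊞ σ) ++ β))
    -- The outer chain puts the part `b` in front of `μ`, on c + 1 variables; branching off the last
    -- of these returns to `c` variables and prepends its exponent to `β`.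
    ≡⟨ ∑-cong-∈ (strips c b) (λ (μ , β) μ∈ → let len , parts , _ = strips-parts c b μ∈ in
         trans (∑-cong-∈ (schur c μ) λ σ σ∈ → move β σ (length-schur c μ σ∈))
         (trans (π*-schur c b μ (λ γ → φ (p ++ (stair 0 c ∷ʳ 0) ⊞ γ ++ β)) len parts)
         (trans (∑-schur c b μ _)
         (∑-cong (below b μ) λ (ν , w) → ∑-cong-∈ (schur c ν) λ σ σ∈ →
           cong (λ α → φ (p ++ α)) (absorb β w σ (length-schur c ν σ∈)))))) ⟩
  ∑ (strips c b) (λ (μ , β) → ∑ (below b μ) λ (ν , w) → ∑ (schur c ν) λ σ →
    φ (p ++ (downFrom c ⊞ σ) ++ w ∷ β))
    ≡⟨ ∑-strips c b _ ⟨
  ∑ (strips c (suc b)) (λ (μ , β) → ∑ (schur c μ) λ σ → φ (p ++ (downFrom c ⊞ σ) ++ β)) ∎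
  where
  φ₁ : Exp → ℤ
  φ₁ = δ* (map (length p +_) (downFrom c)) φ

  move : ∀ β σ → length σ ≡ c → φ₁ ((p ∷ʳ (b + c)) ++ (downFrom c ⊞ σ) ++ β) ≡
    π* c (λ γ → φ (p ++ (stair 0 c ∷ʳ 0) ⊞ γ ++ β)) (b ∷ σ)
  move β σ σ≡ = begin
    φ₁ ((p ∷ʳ (b + c)) ++ (downFrom c ⊞ σ) ++ β)
      ≡⟨ cong φ₁ (++-assoc p [ b + c ] _) ⟩
    φ₁ (p ++ (b + c ∷ downFrom c ⊞ σ) ++ β)
      ≡⟨ δ*-++ʳ (downFrom c) p ((b + c ∷ downFrom c ⊞ σ) ++ β) φ
           (All.map (λ i< → ≤-trans (s≤s i<) (subst₂ _≤_ len (sym (length-++ (b + c ∷ downFrom c ⊞ σ)))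
             (m≤m+n _ (length β)))) (downFrom-< c)) ⟩
    δ* (downFrom c) (λ γ → φ (p ++ γ)) ((b + c ∷ downFrom c ⊞ σ) ++ β)
      ≡⟨ δ*-++ˡ (downFrom c) (b + c ∷ downFrom c ⊞ σ) β (λ γ → φ (p ++ γ))
           (All.map (λ i< → ≤-trans (s≤s i<) (≤-reflexive (sym len))) (downFrom-< c)) ⟩
    δ* (downFrom c) (λ γ → φ (p ++ γ ++ β)) (b + c ∷ downFrom c ⊞ σ)
      -- The exponent b + c is the top step c of a staircase with c + 1 steps, plus a surplus b:
      -- this surplus is the new part.
      ≡⟨ cong₂ (λ x α → δ* (downFrom c) (λ γ → φ (p ++ γ ++ β)) (x ∷ α ⊞ σ)) (+-comm b c)
           (trans (sym (stair-0 c)) (sym (++-identityʳ (stair 0 c)))) ⟩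
    δ* (downFrom c) (λ γ → φ (p ++ γ ++ β)) ((stair 0 (suc c) ++ []) ⊞ (b ∷ σ))
      ≡⟨ δ*-stair c 0 [] (b ∷ σ) (λ γ → φ (p ++ γ ++ β)) (cong suc (trans σ≡ (sym (+-identityʳ c)))) ⟩
    π* c (λ γ → φ (p ++ (stair 0 c ∷ʳ 0) ⊞ γ ++ β)) (b ∷ σ) ∎
    where
    len : length (b + c ∷ downFrom c ⊞ σ) ≡ suc c
    len = cong suc (trans (length-⊞ (downFrom c) σ (trans (length-downFrom c) (sym σ≡))) (length-downFrom c))

  absorb : ∀ β w σ → length σ ≡ c → (stair 0 c ∷ʳ 0) ⊞ (σ ∷ʳ w) ++ β ≡ (downFrom c ⊞ σ) ++ w ∷ β
  absorb β w σ σ≡ = begin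
    (stair 0 c ∷ʳ 0) ⊞ (σ ∷ʳ w) ++ β   ≡⟨ cong (_++ β) (⊞-++ (stair 0 c) σ (trans (length-stair 0 c) (sym σ≡))) ⟩
    (stair 0 c ⊞ σ ∷ʳ w) ++ β          ≡⟨ ++-assoc (stair 0 c ⊞ σ) [ w ] β ⟩
    (stair 0 c ⊞ σ) ++ w ∷ β           ≡⟨ cong (λ α → (α ⊞ σ) ++ w ∷ β) (stair-0 c) ⟩
    (downFrom c ⊞ σ) ++ w ∷ β          ∎

-- Following first ascents from a layered permutation

schubAux-step : ∀ n k w {i} → firstAscent w ≡ just i → schubAux n (suc k) w ≡ ∂ i (schubAux n k (swapAt i w))
schubAux-step n k w eq rewrite eq = refl

firstAscent-++ : ∀ xs x y t → AllPairs _>_ (xs ∷ʳ x) → x < y → firstAscent (xs ++ x ∷ y ∷ t) ≡ just (length xs)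
firstAscent-++ []            x y t _ x<y rewrite dec-true (x <? y) x<y = refl
firstAscent-++ (z ∷ [])      x y t ((z>x ∷ []) ∷ ps) x<y
  rewrite dec-false (z <? x) (<⇒≯ z>x) = cong (Maybe.map suc) (firstAscent-++ [] x y t ps x<y)
firstAscent-++ (z ∷ z′ ∷ xs) x y t ((z>z′ ∷ _) ∷ ps) x<y
  rewrite dec-false (z <? z′) (<⇒≯ z>z′) = cong (Maybe.map suc) (firstAscent-++ (z′ ∷ xs) x y t ps x<y)

AllPairs-++ˡ : ∀ (xs : List ℕ) {ys} → AllPairs _>_ (xs ++ ys) → AllPairs _>_ xs
AllPairs-++ˡ []       _        = []
AllPairs-++ˡ (x ∷ xs) (p ∷ ps) = All.++⁻ˡ xs p ∷ AllPairs-++ˡ xs ps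

AllPairs-insert : ∀ (ps : List ℕ) y {xs ys} →
  AllPairs _>_ (ps ++ y ∷ ys) → AllPairs _>_ (ps ++ xs) → All (_< y) xs → AllPairs _>_ (ps ++ y ∷ xs)
AllPairs-insert []       y _        qs       ys> = ys> ∷ qs
AllPairs-insert (p ∷ ps) y (r ∷ rs) (q ∷ qs) ys> =
  All.++⁺ (All.++⁻ˡ ps q) (All.head (All.++⁻ʳ ps r) ∷ All.++⁻ʳ ps q) ∷ AllPairs-insert ps y rs qs ys>

-- Everything before `y` is decreasing and the entries of `xs` are smaller than `y`, so the first
-- ascent always ends at `y`. The entry `y` meets the last entry of `xs` first, whence the reverse
-- view.
schubAux-moveLeft : ∀ n K ps {xs} y t → Reverse xs → AllPairs _>_ (ps ++ xs) → All (_< y) xs →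
  schubAux n (length xs + K) (ps ++ xs ++ y ∷ t) ≡
  foldr ∂ (schubAux n K (ps ++ y ∷ xs ++ t)) (map (length ps +_) (downFrom (length xs)))
schubAux-moveLeft n K ps y t []             _   _   = refl
schubAux-moveLeft n K ps y t (xs ∶ rxs ∶ʳ x) dec xs< = begin
  schubAux n (length (xs ∷ʳ x) + K) (ps ++ (xs ∷ʳ x) ++ y ∷ t)
    ≡⟨ cong₂ (λ l w → schubAux n (l + K) w) len
         (trans (cong (ps ++_) (++-assoc xs [ x ] (y ∷ t))) (sym (++-assoc ps xs (x ∷ y ∷ t)))) ⟩
  schubAux n (suc (length xs + K)) ((ps ++ xs) ++ x ∷ y ∷ t)
    ≡⟨ schubAux-step n (length xs + K) _ (firstAscent-++ (ps ++ xs) x y t dec′ (All.head (All.++⁻ʳ xs xs<))) ⟩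
  ∂ (length (ps ++ xs)) (schubAux n (length xs + K) (swapAt (length (ps ++ xs)) ((ps ++ xs) ++ x ∷ y ∷ t)))
    ≡⟨ cong₂ (λ i w → ∂ i (schubAux n (length xs + K) w)) (length-++ ps)
         (trans (swapAt-++ (ps ++ xs) x y t) (++-assoc ps xs (y ∷ x ∷ t))) ⟩
  ∂ (length ps + length xs) (schubAux n (length xs + K) (ps ++ xs ++ y ∷ x ∷ t))
    ≡⟨ cong (∂ (length ps + length xs)) (schubAux-moveLeft n K ps y (x ∷ t) rxs
         (AllPairs-++ˡ (ps ++ xs) dec′) (All.++⁻ˡ xs xs<)) ⟩
  foldr ∂ (schubAux n K (ps ++ y ∷ xs ++ x ∷ t)) (map (length ps +_) (downFrom (suc (length xs))))
    ≡⟨ cong₂ (λ w l → foldr ∂ (schubAux n K (ps ++ y ∷ w)) (map (length ps +_) (downFrom l)))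
         (++-assoc xs [ x ] t) len ⟨
  foldr ∂ (schubAux n K (ps ++ y ∷ (xs ∷ʳ x) ++ t)) (map (length ps +_) (downFrom (length (xs ∷ʳ x)))) ∎
  where
  len : length (xs ∷ʳ x) ≡ suc (length xs)
  len = trans (length-++ xs) (+-comm (length xs) 1)
  dec′ : AllPairs _>_ ((ps ++ xs) ∷ʳ x)
  dec′ = subst (AllPairs _>_) (sym (++-assoc ps xs [ x ])) dec

-- Once `y` has moved, `ps`, `y`, `xs` form the decreasing run, so the next first ascent ends at the
-- next entry of `ys`; every entry costs `length xs` steps.
schubAux-merge : ∀ n K ps xs ys t → AllPairs _>_ (ps ++ ys) → AllPairs _>_ (ps ++ xs) →
  All (λ y → All (_< y) xs) ys →
  schubAux n (length ys * length xs + K) (ps ++ xs ++ ys ++ t) ≡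
  foldr ∂ (schubAux n K ((ps ++ ys) ++ xs ++ t)) (mergeWord (length ps) (length xs) (length ys))
schubAux-merge n K ps xs []       t _  _  _ = cong (λ w → schubAux n K (w ++ xs ++ t)) (sym (++-identityʳ ps))
schubAux-merge n K ps xs (y ∷ ys) t dy dx (xs<y ∷ xs<ys) = begin
  schubAux n (length xs + length ys * length xs + K) (ps ++ xs ++ y ∷ ys ++ t)
    ≡⟨ cong (λ k → schubAux n k (ps ++ xs ++ y ∷ ys ++ t)) (+-assoc (length xs) _ K) ⟩
  schubAux n (length xs + K′) (ps ++ xs ++ y ∷ ys ++ t)
    ≡⟨ schubAux-moveLeft n K′ ps y (ys ++ t) (reverseView xs) dx xs<y ⟩
  foldr ∂ (schubAux n K′ (ps ++ y ∷ xs ++ ys ++ t)) chain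
    ≡⟨ cong (λ w → foldr ∂ (schubAux n K′ w) chain) (sym (++-assoc ps [ y ] (xs ++ ys ++ t))) ⟩
  foldr ∂ (schubAux n K′ ((ps ∷ʳ y) ++ xs ++ ys ++ t)) chain
    ≡⟨ cong (λ f → foldr ∂ f chain) (schubAux-merge n K (ps ∷ʳ y) xs ys t
         (subst (AllPairs _>_) (sym (++-assoc ps [ y ] ys)) dy)
         (subst (AllPairs _>_) (sym (++-assoc ps [ y ] xs)) (AllPairs-insert ps y dy dx xs<y)) xs<ys) ⟩
  foldr ∂ (foldr ∂ (schubAux n K (((ps ∷ʳ y) ++ ys) ++ xs ++ t))
    (mergeWord (length (ps ∷ʳ y)) (length xs) (length ys))) chain
    ≡⟨ cong₂ (λ w j → foldr ∂ (foldr ∂ (schubAux n K (w ++ xs ++ t)) (mergeWord j (length xs) (length ys))) chain)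
         (++-assoc ps [ y ] ys) (trans (length-++ ps) (+-comm (length ps) 1)) ⟩
  foldr ∂ (foldr ∂ (schubAux n K ((ps ++ y ∷ ys) ++ xs ++ t))
    (mergeWord (suc (length ps)) (length xs) (length ys))) chain
    ≡⟨ foldr-++ ∂ _ chain _ ⟨
  foldr ∂ (schubAux n K ((ps ++ y ∷ ys) ++ xs ++ t)) (mergeWord (length ps) (length xs) (length (y ∷ ys))) ∎
  where
  K′ = length ys * length xs + K
  chain = map (length ps +_) (downFrom (length xs))

block : ℕ → ℕ → List ℕ
block c zero    = []
block c (suc b) = suc (c + b) ∷ block c b

block-def : ∀ c b → map (λ k → c + b ∸ k) (upTo b) ≡ block c b
block-def c zero    = refl
block-def c (suc b) = cong₂ _∷_ (+-suc c b) (begin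
  map (λ k → c + suc b ∸ k) (applyUpTo suc b)    ≡⟨ cong (map _) (map-upTo suc b) ⟨
  map (λ k → c + suc b ∸ k) (map suc (upTo b))             ≡⟨ map-∘ (upTo b) ⟨
  map (λ k → c + suc b ∸ suc k) (upTo b)                   ≡⟨ map-cong (λ k → cong (_∸ suc k) (+-suc c b)) (upTo b) ⟩
  map (λ k → c + b ∸ k) (upTo b)                           ≡⟨ block-def c b ⟩
  block c b                                                ∎)

length-block : ∀ c b → length (block c b) ≡ b
length-block c zero    = refl
length-block c (suc b) = cong suc (length-block c b)

block-bounds : ∀ c b → All (λ x → c < x × x ≤ c + b) (block c b)
block-bounds c zero    = []
block-bounds c (suc b) = (s≤s (m≤m+n c b) , ≤-reflexive (sym (+-suc c b))) ∷
  All.map (λ (p , q) → p , ≤-trans q (+-monoʳ-≤ c (n≤1+n b))) (block-bounds c b)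

block-decreasing : ∀ c b → AllPairs _>_ (block c b)
block-decreasing c zero    = []
block-decreasing c (suc b) = All.map (λ (_ , q) → s≤s q) (block-bounds c b) ∷ block-decreasing c b

block-++ : ∀ c b → block c b ++ block 0 c ≡ block 0 (c + b)
block-++ c zero    = cong (block 0) (sym (+-identityʳ c))
block-++ c (suc b) = trans (cong (suc (c + b) ∷_) (block-++ c b)) (cong (block 0) (sym (+-suc c b)))

-- Counts non-inversions when the first `c` entries are already merged into one decreasing block:
-- every later block forms them with all that precedes it.
fuel : ℕ → List ℕ → ℕ
fuel c []       = 0
fuel c (b ∷ bs) = b * c + fuel (c + b) bs

word : ℕ → List ℕ → List ℕ
word c []       = []
word c (b ∷ bs) = mergeWord 0 c b ++ word (c + b) bs

schubAux-layered : ∀ n c bs →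
  schubAux n (fuel c bs) (block 0 c ++ layeredFrom c bs) ≡ foldr ∂ (schubW0 n) (word c bs)
schubAux-layered n c []       = refl
schubAux-layered n c (b ∷ bs) = begin
  schubAux n (b * c + K) (block 0 c ++ map (λ k → c + b ∸ k) (upTo b) ++ rest)
    ≡⟨ cong (λ ys → schubAux n (b * c + K) (block 0 c ++ ys ++ rest)) (block-def c b) ⟩
  schubAux n (b * c + K) (block 0 c ++ block c b ++ rest)
    ≡⟨ cong₂ (λ u v → schubAux n (u * v + K) (block 0 c ++ block c b ++ rest))
         (length-block c b) (length-block 0 c) ⟨
  schubAux n (length (block c b) * length (block 0 c) + K) (block 0 c ++ block c b ++ rest)
    ≡⟨ schubAux-merge n K [] (block 0 c) (block c b) rest (block-decreasing c b) (block-decreasing 0 c)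
         (All.map (λ (c<y , _) → All.map (λ (_ , x≤c) → ≤-<-trans x≤c c<y) (block-bounds 0 c)) (block-bounds c b)) ⟩
  foldr ∂ (schubAux n K (block c b ++ block 0 c ++ rest)) (mergeWord 0 (length (block 0 c)) (length (block c b)))
    ≡⟨ cong₂ (λ u v → foldr ∂ (schubAux n K (block c b ++ block 0 c ++ rest)) (mergeWord 0 u v))
         (length-block 0 c) (length-block c b) ⟩
  foldr ∂ (schubAux n K (block c b ++ block 0 c ++ rest)) (mergeWord 0 c b)
    ≡⟨ cong (λ w → foldr ∂ (schubAux n K w) (mergeWord 0 c b))
         (trans (sym (++-assoc (block c b) (block 0 c) rest)) (cong (_++ rest) (block-++ c b))) ⟩
  foldr ∂ (schubAux n K (block 0 (c + b) ++ rest)) (mergeWord 0 c b)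
    ≡⟨ cong (λ f → foldr ∂ f (mergeWord 0 c b)) (schubAux-layered n (c + b) bs) ⟩
  foldr ∂ (foldr ∂ (schubW0 n) (word (c + b) bs)) (mergeWord 0 c b)
    ≡⟨ foldr-++ ∂ _ (mergeWord 0 c b) _ ⟨
  foldr ∂ (schubW0 n) (word c (b ∷ bs)) ∎
  where
  K = fuel (c + b) bs
  rest = layeredFrom (c + b) bs

layeredFrom-> : ∀ c bs → All (c <_) (layeredFrom c bs)
layeredFrom-> c []       = []
layeredFrom-> c (b ∷ bs) = All.++⁺
  (subst (All (c <_)) (sym (block-def c b)) (All.map proj₁ (block-bounds c b)))
  (All.map (≤-<-trans (m≤m+n c b)) (layeredFrom-> (c + b) bs))

length-layeredFrom : ∀ c bs → length (layeredFrom c bs) ≡ sum bs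
length-layeredFrom c []       = refl
length-layeredFrom c (b ∷ bs) = trans (length-++ (map (λ k → c + b ∸ k) (upTo b)))
  (cong₂ _+_ (trans (cong length (block-def c b)) (length-block c b)) (length-layeredFrom (c + b) bs))

nonInv-decreasing : ∀ {xs} → AllPairs _>_ xs → nonInv xs ≡ 0
nonInv-decreasing []                 = refl
nonInv-decreasing {x ∷ xs} (p ∷ ps) = cong₂ _+_
  (cong length (filter-none (x <?_) (All.map <⇒≯ p))) (nonInv-decreasing ps)

nonInv-++ : ∀ xs ys → All (λ x → All (x <_) ys) xs →
  nonInv (xs ++ ys) ≡ nonInv xs + length xs * length ys + nonInv ys
nonInv-++ []       ys _        = refl
nonInv-++ (x ∷ xs) ys (p ∷ ps) = begin
  length (filter (x <?_) (xs ++ ys)) + nonInv (xs ++ ys)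
    ≡⟨ cong₂ _+_ (trans (cong length (filter-++ (x <?_) xs ys)) (length-++ (filter (x <?_) xs)))
         (nonInv-++ xs ys ps) ⟩
  length (filter (x <?_) xs) + length (filter (x <?_) ys) + (nonInv xs + length xs * length ys + nonInv ys)
    ≡⟨ cong (λ zs → length (filter (x <?_) xs) + length zs + (nonInv xs + length xs * length ys + nonInv ys))
         (filter-all (x <?_) p) ⟩
  length (filter (x <?_) xs) + length ys + (nonInv xs + length xs * length ys + nonInv ys)
    ≡⟨ eq (length (filter (x <?_) xs)) (length ys) (nonInv xs) (length xs * length ys) (nonInv ys) ⟩
  length (filter (x <?_) xs) + nonInv xs + (length ys + length xs * length ys) + nonInv ys ∎
  where
  eq : ∀ a b c d e → a + b + (c + d + e) ≡ a + c + (b + d) + e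
  eq = ℕ-Solver.solve-∀

-- The summand `c * sum bs` accounts for pairs of a merged entry and a later one; it carries the
-- induction over the blocks and vanishes at c = 0.
fuel-nonInv : ∀ c bs → fuel c bs ≡ c * sum bs + nonInv (layeredFrom c bs)
fuel-nonInv c []       = sym (trans (+-identityʳ (c * 0)) (*-zeroʳ c))
fuel-nonInv c (b ∷ bs) = begin
  b * c + fuel (c + b) bs
    ≡⟨ cong (b * c +_) (fuel-nonInv (c + b) bs) ⟩
  b * c + ((c + b) * sum bs + nonInv rest)
    ≡⟨ eq b c (sum bs) (nonInv rest) ⟩
  c * (b + sum bs) + (b * sum bs + nonInv rest)
    ≡⟨ cong (λ k → c * (b + sum bs) + (k + nonInv rest)) (begin
         b * sum bs
           ≡⟨ cong₂ _*_ (length-block c b) (length-layeredFrom (c + b) bs) ⟨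
         length (block c b) * length rest
           ≡⟨ cong (_+ length (block c b) * length rest) (nonInv-decreasing (block-decreasing c b)) ⟨
         nonInv (block c b) + length (block c b) * length rest ∎) ⟩
  c * (b + sum bs) + (nonInv (block c b) + length (block c b) * length rest + nonInv rest)
    ≡⟨ cong (c * (b + sum bs) +_) (nonInv-++ (block c b) rest
         (All.map (λ (_ , x≤) → All.map (≤-<-trans x≤) (layeredFrom-> (c + b) bs)) (block-bounds c b))) ⟨
  c * (b + sum bs) + nonInv (block c b ++ rest)
    ≡⟨ cong (λ ys → c * (b + sum bs) + nonInv (ys ++ rest)) (block-def c b) ⟨
  c * (b + sum bs) + nonInv (layeredFrom c (b ∷ bs)) ∎
  where
  rest = layeredFrom (c + b) bs
  eq : ∀ b c s r → b * c + ((c + b) * s + r) ≡ c * (b + s) + (b * s + r)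
  eq = ℕ-Solver.solve-∀

schubert-layered : ∀ bs → schubert (layered bs) ≡ foldr ∂ (schubW0 (sum bs)) (word 0 bs)
schubert-layered bs = begin
  schubAux (length (layered bs)) (nonInv (layered bs)) (layered bs)
    ≡⟨ cong₂ (λ n k → schubAux n k (layered bs)) (length-layeredFrom 0 bs) (sym (fuel-nonInv 0 bs)) ⟩
  schubAux (sum bs) (fuel 0 bs) (layered bs)
    ≡⟨ schubAux-layered (sum bs) 0 bs ⟩
  foldr ∂ (schubW0 (sum bs)) (word 0 bs) ∎

-- Multiplication by symmetric polynomials

-- Symmetry of s_μ kills the second Leibniz term, so multiplication by s_μ x^β commutes with ∂_i as
-- long as ∂_i stays within the first `c` variables.
δ-schur : ∀ K c μ i α β φ → length μ ≡ c → Parts≤ K μ → length α ≡ c → 2 + i ≤ c →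
  ∑ (schur c μ) (λ σ → δ i φ (α ⊞ σ ++ β)) ≡ δ i (λ γ → ∑ (schur c μ) λ σ → φ (γ ⊞ σ ++ β)) α
δ-schur K c μ i α β φ μ≡ parts α≡ i< = begin
  ∑ (schur c μ) (λ σ → δ i φ (α ⊞ σ ++ β))
    ≡⟨ ∑-cong-∈ (schur c μ) (λ σ σ∈ → trans
         (δ-++ˡ i (α ⊞ σ) β φ (subst (2 + i ≤_) (sym (trans (length-⊞ α σ (α≡σ σ∈)) α≡)) i<))
         (δ-leibniz i α σ φ′ (α≡σ σ∈) (subst (2 + i ≤_) (sym α≡) i<))) ⟩
  ∑ (schur c μ) (λ σ → δ i (λ γ → φ′ (γ ⊞ σ)) α +ᶻ δ i (λ γ → φ′ (swapAt i α ⊞ γ)) σ)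
    ≡⟨ ∑-distrib-+ (schur c μ) _ _ ⟩
  ∑ (schur c μ) (λ σ → δ i (λ γ → φ′ (γ ⊞ σ)) α) +ᶻ ∑ (schur c μ) (δ i (λ γ → φ′ (swapAt i α ⊞ γ)))
    ≡⟨ cong₂ _+ᶻ_ (sym (δ-∑ i α (schur c μ) λ σ γ → φ′ (γ ⊞ σ)))
         (schur-symmetric K c μ i (λ γ → φ′ (swapAt i α ⊞ γ)) μ≡ parts i<) ⟩
  δ i (λ γ → ∑ (schur c μ) λ σ → φ′ (γ ⊞ σ)) α +ᶻ 0ℤ
    ≡⟨ ℤₚ.+-identityʳ _ ⟩
  δ i (λ γ → ∑ (schur c μ) λ σ → φ′ (γ ⊞ σ)) α ∎
  where
  φ′ : Exp → ℤ
  φ′ γ = φ (γ ++ β)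
  α≡σ : ∀ {σ} → σ ∈ schur c μ → length α ≡ length σ
  α≡σ σ∈ = trans α≡ (sym (length-schur c μ σ∈))

δ*-schur : ∀ K c μ is α β φ → length μ ≡ c → Parts≤ K μ → length α ≡ c → All (λ i → 2 + i ≤ c) is →
  ∑ (schur c μ) (λ σ → δ* is φ (α ⊞ σ ++ β)) ≡ δ* is (λ γ → ∑ (schur c μ) λ σ → φ (γ ⊞ σ ++ β)) α
δ*-schur K c μ []       α β φ μ≡ parts α≡ []         = refl
δ*-schur K c μ (i ∷ is) α β φ μ≡ parts refl (i< ∷ is<) = trans
  (δ*-schur K c μ is α β (δ i φ) μ≡ parts refl is<)
  (δ*-cong is α is< λ γ γ≡ → δ-schur K c μ i γ β φ μ≡ parts γ≡ i<)

δ*-∑ : ∀ is α (xs : List A) (φ : A → Exp → ℤ) → All (λ i → 2 + i ≤ length α) is →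
  δ* is (λ γ → ∑ xs λ x → φ x γ) α ≡ ∑ xs λ x → δ* is (φ x) α
δ*-∑ []       α xs φ []         = refl
δ*-∑ (i ∷ is) α xs φ (i< ∷ is<) = trans
  (δ*-cong is α is< λ γ _ → δ-∑ i γ xs φ) (δ*-∑ is α xs (δ i ∘ φ) is<)

mergeWord-< : ∀ j c b → All (λ i → 2 + i ≤ j + (c + b)) (mergeWord j c b)
mergeWord-< j c zero    = []
mergeWord-< j c (suc b) = All.++⁺
  (All.map⁺ (All.map bound (downFrom-< c)))
  (subst (λ n → All (λ i → 2 + i ≤ n) (mergeWord (suc j) c b)) (eq j c b) (mergeWord-< (suc j) c b))
  where
  eq : ∀ j c b → suc j + (c + b) ≡ j + (c + suc b)
  eq = ℕ-Solver.solve-∀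
  bound : ∀ {i} → i < c → 2 + (j + i) ≤ j + (c + suc b)
  bound {i} i<c = subst (_≤ j + (c + suc b)) (trans (+-suc j (suc i)) (cong suc (+-suc j i)))
    (+-monoʳ-≤ j (subst (suc (suc i) ≤_) (sym (+-suc c b)) (s≤s (≤-trans i<c (m≤m+n c b)))))

word-< : ∀ c bs → All (λ i → 2 + i ≤ c + sum bs) (word c bs)
word-< c []       = []
word-< c (b ∷ bs) = All.++⁺
  (All.map (λ p → ≤-trans p (+-monoʳ-≤ c (m≤m+n b (sum bs)))) (mergeWord-< 0 c b))
  (subst (λ n → All (λ i → 2 + i ≤ n) (word (c + b) bs)) (+-assoc c b (sum bs)) (word-< (c + b) bs))

-- Blocks are merged from left to right, so the last block takes part in the last merge only. Hence
-- the word of w′ is a prefix of the word of w.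
word-∷ʳ : ∀ c bs b → word c (bs ∷ʳ b) ≡ word c bs ++ mergeWord 0 (c + sum bs) b
word-∷ʳ c []        b = trans (++-identityʳ _) (cong (λ x → mergeWord 0 x b) (sym (+-identityʳ c)))
word-∷ʳ c (b′ ∷ bs) b = begin
  mergeWord 0 c b′ ++ word (c + b′) (bs ∷ʳ b)
    ≡⟨ cong (mergeWord 0 c b′ ++_) (word-∷ʳ (c + b′) bs b) ⟩
  mergeWord 0 c b′ ++ word (c + b′) bs ++ mergeWord 0 (c + b′ + sum bs) b
    ≡⟨ ++-assoc (mergeWord 0 c b′) _ _ ⟨
  word c (b′ ∷ bs) ++ mergeWord 0 (c + b′ + sum bs) b
    ≡⟨ cong (λ x → word c (b′ ∷ bs) ++ mergeWord 0 x b) (+-assoc c b′ (sum bs)) ⟩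
  word c (b′ ∷ bs) ++ mergeWord 0 (c + sum (b′ ∷ bs)) b ∎

-- Schubert polynomials as sums of monomials

multiply : ℕ → ℕ → List Exp → List Exp
multiply c b = concatMap λ α → concatMap (λ (μ , β) → map (λ σ → α ⊞ σ ++ β) (schur c μ)) (strips c b)

∑-multiply : ∀ c b αs f → ∑ (multiply c b αs) f ≡
  ∑ αs λ α → ∑ (strips c b) λ (μ , β) → ∑ (schur c μ) λ σ → f (α ⊞ σ ++ β)
∑-multiply c b αs f = trans (∑-concatMap _ αs f) (∑-cong αs λ α → trans
  (∑-concatMap _ (strips c b) f) (∑-cong (strips c b) λ (μ , β) → ∑-map (λ σ → α ⊞ σ ++ β) (schur c μ) f))

-- Testing against every functional gives equality of polynomials regardless of cancellation within
-- `f`; since each exponent in `αs` counts with coefficient 1, it also records nonnegativity.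
_IsSumOf_ : Poly → List Exp → Set
f IsSumOf αs = ∀ φ → ⟨ f , φ ⟩ ≡ ∑ αs φ

⟨schubert-layered,⟩ : ∀ bs φ → ⟨ schubert (layered bs) , φ ⟩ ≡ δ* (word 0 bs) φ (downFrom (sum bs))
⟨schubert-layered,⟩ bs φ = begin
  ⟨ schubert (layered bs) , φ ⟩                          ≡⟨ cong (λ f → ⟨ f , φ ⟩) (schubert-layered bs) ⟩
  ⟨ foldr ∂ (schubW0 (sum bs)) (word 0 bs) , φ ⟩         ≡⟨ ⟨foldr-∂,⟩ (word 0 bs) (schubW0 (sum bs)) φ ⟩
  1ℤ *ᶻ δ* (word 0 bs) φ (reverse (upTo (sum bs))) +ᶻ 0ℤ
    ≡⟨ trans (ℤₚ.+-identityʳ _) (ℤₚ.*-identityˡ _) ⟩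
  δ* (word 0 bs) φ (reverse (upTo (sum bs)))   ≡⟨ cong (δ* (word 0 bs) φ) (reverse-upTo (sum bs)) ⟩
  δ* (word 0 bs) φ (downFrom (sum bs))                   ∎

schubert-∷ʳ : ∀ bs b αs → schubert (layered bs) IsSumOf αs →
  schubert (layered (bs ∷ʳ b)) IsSumOf multiply (sum bs) b αs
schubert-∷ʳ bs b αs sumOf φ = begin
  ⟨ schubert (layered (bs ∷ʳ b)) , φ ⟩
    ≡⟨ ⟨schubert-layered,⟩ (bs ∷ʳ b) φ ⟩
  δ* (word 0 (bs ∷ʳ b)) φ (downFrom (sum (bs ∷ʳ b)))
    ≡⟨ cong₂ (λ w n → δ* w φ (downFrom n)) (word-∷ʳ 0 bs b)
         (trans (sum-++ bs [ b ]) (trans (+-comm c (b + 0)) (cong (_+ c) (+-identityʳ b)))) ⟩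
  δ* (word 0 bs ++ mergeWord 0 c b) φ (downFrom (b + c))
    ≡⟨ δ*-++ (word 0 bs) (mergeWord 0 c b) φ _ ⟩
  δ* (mergeWord 0 c b) (δ* (word 0 bs) φ) (downFrom (b + c))
    ≡⟨ δ*-mergeWord c b [] (δ* (word 0 bs) φ) ⟩
  ∑ (strips c b) (λ (μ , β) → ∑ (schur c μ) λ σ → δ* (word 0 bs) φ (downFrom c ⊞ σ ++ β))
    ≡⟨ ∑-cong-∈ (strips c b) (λ (μ , β) μ∈ → let len , parts , _ = strips-parts c b μ∈ in
         δ*-schur b c μ (word 0 bs) (downFrom c) β φ len parts (length-downFrom c) (word-< 0 bs)) ⟩
  ∑ (strips c b) (λ (μ , β) → δ* (word 0 bs) (λ γ → ∑ (schur c μ) λ σ → φ (γ ⊞ σ ++ β)) (downFrom c))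
    ≡⟨ δ*-∑ (word 0 bs) (downFrom c) (strips c b) (λ (μ , β) γ → ∑ (schur c μ) λ σ → φ (γ ⊞ σ ++ β))
         (subst (λ n → All (λ i → 2 + i ≤ n) (word 0 bs)) (sym (length-downFrom c)) (word-< 0 bs)) ⟨
  δ* (word 0 bs) φ′ (downFrom c)
    ≡⟨ ⟨schubert-layered,⟩ bs φ′ ⟨
  ⟨ schubert (layered bs) , φ′ ⟩
    ≡⟨ sumOf φ′ ⟩
  ∑ αs φ′
    ≡⟨ ∑-multiply c b αs φ ⟨
  ∑ (multiply c b αs) φ ∎
  where
  c = sum bs
  -- The transpose of multiplication by Q: `φ` paired with x^γ Q.
  φ′ : Exp → ℤ
  φ′ γ = ∑ (strips c b) λ (μ , β) → ∑ (schur c μ) λ σ → φ (γ ⊞ σ ++ β)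

∈-multiply⁺ : ∀ c b αs {α μ β σ} → α ∈ αs → (μ , β) ∈ strips c b → σ ∈ schur c μ →
  α ⊞ σ ++ β ∈ multiply c b αs
∈-multiply⁺ c b αs {α} {μ} {β} α∈ μ∈ σ∈ = ∈-concatMap⁺ _ (lose α∈ (∈-concatMap⁺ _ (lose μ∈ (∈-map⁺ _ σ∈))))

length-multiply : ∀ c b αs {γ} → All (λ α → length α ≡ c) αs → γ ∈ multiply c b αs → length γ ≡ c + b
length-multiply c b αs lens γ∈
  with α , α∈ , γ∈′ ← find (∈-concatMap⁻ (λ α → concatMap (λ (μ , β) → map (λ σ → α ⊞ σ ++ β) (schur c μ)) (strips c b)) {xs = αs} γ∈)
  with (μ , β) , μ∈ , γ∈″ ← find (∈-concatMap⁻ (λ (μ , β) → map (λ σ → α ⊞ σ ++ β) (schur c μ)) {xs = strips c b} γ∈′)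
  with σ , σ∈ , refl ← ∈-map⁻ (λ σ → α ⊞ σ ++ β) γ∈″
  with _ , _ , β≡ ← strips-parts c b μ∈
  with α≡ ← All.lookup lens α∈ =
  trans (length-++ (α ⊞ σ)) (cong₂ _+_
    (trans (length-⊞ α σ (trans α≡ (sym (length-schur c μ σ∈)))) α≡) β≡)

-- The induction removes the last block and starts from the constant 1 in no variables. Lengths are
-- recorded because cancelling a summand of `_⊞_` requires vectors of equal length.
schubert-positive : ∀ {bs} → Reverse bs →
  ∃ λ αs → schubert (layered bs) IsSumOf αs × All (λ α → length α ≡ sum bs) αs
schubert-positive []              = [ [] ] , (λ φ → cong (_+ᶻ 0ℤ) (ℤₚ.*-identityˡ (φ []))) , refl ∷ []
schubert-positive (bs ∶ rbs ∶ʳ b) with αs , sumOf , lens ← schubert-positive rbs =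
  multiply (sum bs) b αs , schubert-∷ʳ bs b αs sumOf ,
  All.tabulate λ γ∈ → trans (length-multiply (sum bs) b αs lens γ∈)
    (trans (cong (_+_ (sum bs)) (sym (+-identityʳ b))) (sym (sum-++ bs [ b ])))

-- Supports

𝟙 : Exp → Exp → ℤ
𝟙 γ α = if does (α ≟ₑ γ) then 1ℤ else 0ℤ

coeff-⟨⟩ : ∀ f γ → coeff f γ ≡ ⟨ f , 𝟙 γ ⟩
coeff-⟨⟩ []            γ = refl
coeff-⟨⟩ ((α , c) ∷ f) γ = cong₂ _+ᶻ_ (term (does (α ≟ₑ γ))) (coeff-⟨⟩ f γ)
  where
  term : ∀ t → (if t then c else 0ℤ) ≡ c *ᶻ (if t then 1ℤ else 0ℤ)
  term true  = sym (ℤₚ.*-identityʳ c)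
  term false = sym (ℤₚ.*-zeroʳ c)

coeff-∉ : ∀ f γ → ¬ γ ∈ map proj₁ f → coeff f γ ≡ 0ℤ
coeff-∉ []            γ γ∉ = refl
coeff-∉ ((α , c) ∷ f) γ γ∉ rewrite dec-false (α ≟ₑ γ) (λ { refl → γ∉ (here refl) }) =
  trans (ℤₚ.+-identityˡ _) (coeff-∉ f γ (γ∉ ∘ there))

∑-𝟙-∉ : ∀ αs γ → ¬ γ ∈ αs → ∑ αs (𝟙 γ) ≡ 0ℤ
∑-𝟙-∉ αs γ γ∉ = ∑-zero αs λ α α∈ → cong (if_then 1ℤ else 0ℤ)
  (dec-false (α ≟ₑ γ) λ { refl → γ∉ α∈ })

𝟙-≥0 : ∀ γ α → 0ℤ ℤ.≤ 𝟙 γ α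
𝟙-≥0 γ α with does (α ≟ₑ γ)
... | true  = ℤ.+≤+ z≤n
... | false = ℤₚ.≤-refl

∑-𝟙-≥0 : ∀ αs γ → 0ℤ ℤ.≤ ∑ αs (𝟙 γ)
∑-𝟙-≥0 []       γ = ℤₚ.≤-refl
∑-𝟙-≥0 (α ∷ αs) γ = ℤₚ.+-mono-≤ (𝟙-≥0 γ α) (∑-𝟙-≥0 αs γ)

∑-𝟙-∈ : ∀ αs γ → γ ∈ αs → 0ℤ ℤ.< ∑ αs (𝟙 γ)
∑-𝟙-∈ (α ∷ αs) γ (here refl) rewrite dec-true (α ≟ₑ α) refl =
  ℤₚ.+-mono-<-≤ (ℤ.+<+ (s≤s z≤n)) (∑-𝟙-≥0 αs γ)
∑-𝟙-∈ (α ∷ αs) γ (there γ∈) = ℤₚ.+-mono-≤-< (𝟙-≥0 γ α) (∑-𝟙-∈ αs γ γ∈)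

module _ (f : Poly) (αs : List Exp) (sumOf : f IsSumOf αs) where

  private
    nonzero? = λ α → ¬? (coeff f α ℤ.≟ 0ℤ)

  ∈-supp⁻ : ∀ {γ} → γ ∈ supp f → γ ∈ αs
  ∈-supp⁻ {γ} γ∈ with γ DecMem.∈? αs
  ... | yes γ∈αs = γ∈αs
  ... | no  γ∉αs = contradiction
    (trans (coeff-⟨⟩ f γ) (trans (sumOf (𝟙 γ)) (∑-𝟙-∉ αs γ γ∉αs)))
    (proj₂ (∈-filter⁻ nonzero? {xs = map proj₁ f} (∈-deduplicate⁻ _≟ₑ_ (filter nonzero? (map proj₁ f)) γ∈)))

  ∈-supp⁺ : ∀ {γ} → γ ∈ αs → γ ∈ supp f
  ∈-supp⁺ {γ} γ∈ = ∈-deduplicate⁺ _≟ₑ_ (∈-filter⁺ nonzero? γ∈f coeff≢0)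
    where
    coeff≢0 : ¬ coeff f γ ≡ 0ℤ
    coeff≢0 eq = ℤₚ.<⇒≢ (∑-𝟙-∈ αs γ γ∈) (sym (trans (sym (sumOf (𝟙 γ))) (trans (sym (coeff-⟨⟩ f γ)) eq)))
    -- `supp` searches only the exponents listed in `f`; an unlisted one has coefficient 0.
    γ∈f : γ ∈ map proj₁ f
    γ∈f with γ DecMem.∈? map proj₁ f
    ... | yes p = p
    ... | no ¬p = contradiction (coeff-∉ f γ ¬p) coeff≢0

-- Deleting the value at the head from `ys` leaves room for the other values. Injectivity is asked
-- on `xs` only, as the map to be used takes a default value elsewhere.
length-≤-injection : ∀ (g : A → B) xs ys → Unique xs → (∀ {x} → x ∈ xs → g x ∈ ys) →
  (∀ {x x′} → x ∈ xs → x′ ∈ xs → g x ≡ g x′ → x ≡ x′) → length xs ≤ length ys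
length-≤-injection g []       ys _        _   _   = z≤n
length-≤-injection g (x ∷ xs) ys (x∉ ∷ u) g∈ inj with as , bs , refl ← ∈-∃++ (g∈ (here refl)) =
  ≤-trans (s≤s (length-≤-injection g xs (as ++ bs) u skip λ p q → inj (there p) (there q)))
    (≤-reflexive (trans (cong suc (length-++ as)) (trans (sym (+-suc (length as) (length bs))) (sym (length-++ as)))))
  where
  skip : ∀ {x′} → x′ ∈ xs → g x′ ∈ as ++ bs
  skip x′∈ with ∈-++⁻ as (g∈ (there x′∈))
  ... | inj₁ p         = ∈-++⁺ˡ p
  ... | inj₂ (there p) = ∈-++⁺ʳ as p
  ... | inj₂ (here eq) = contradiction (sym (inj (there x′∈) (here refl) eq)) (All.lookup x∉ x′∈)

-- The exponents of the last variables

length-cartesianProductWith : ∀ {C : Set} (f : A → B → C) xs ys →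
  length (cartesianProductWith f xs ys) ≡ length xs * length ys
length-cartesianProductWith f []       ys = refl
length-cartesianProductWith f (x ∷ xs) ys = trans (length-++ (map (f x) ys))
  (cong₂ _+_ (length-map (f x) ys) (length-cartesianProductWith f xs ys))

-- The exponents of the divisors of x^(k-1,...,1,0).
boxes : ℕ → List Exp
boxes zero    = [ [] ]
boxes (suc k) = cartesianProductWith _∷_ (upTo (suc k)) (boxes k)

boxes-unique : ∀ k → Unique (boxes k)
boxes-unique zero    = [] ∷ []
boxes-unique (suc k) = cartesianProductWith⁺ _∷_ ∷-injective (upTo⁺ (suc k)) (boxes-unique k)

length-boxes : ∀ k → length (boxes k) ≡ k !
length-boxes zero    = refl
length-boxes (suc k) = trans (length-cartesianProductWith _∷_ (upTo (suc k)) (boxes k))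
  (cong₂ _*_ (length-upTo (suc k)) (length-boxes k))

∈-below⁺ : ∀ {k m μ j ν w} → m ≤ j → j ≤ k → (ν , w) ∈ below m μ → (j ∷ ν , k ∸ j + w) ∈ below k (m ∷ μ)
∈-below⁺ m≤j j≤k ν∈ = ∈-concatMap⁺ _ (lose (∈-range⁺ m≤j j≤k) (∈-map⁺ _ ν∈))

-- Greedy choice: boxes are removed from the first row until it has length `m`, and the remaining
-- ones from the rows below; the row allowances add up to `k`. The trailing 0 is the part that any
-- strip must contain whole, so size 0 is also possible.
strip-of-size : ∀ k μ e → Parts≤ k μ → e ≤ k → ∃ λ ν → (ν , e) ∈ below k (μ ∷ʳ 0)
strip-of-size k []      e _ e≤k = [ k ∸ e ] ,
  subst (λ w → ([ k ∸ e ] , w) ∈ below k [ 0 ]) (trans (+-identityʳ _) (m∸[m∸n]≡n e≤k))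
    (∈-below⁺ {μ = []} {w = 0} z≤n (m∸n≤m k e) (here refl))
strip-of-size k (m ∷ μ) e (m≤k , parts) e≤k with e ≤? k ∸ m
... | yes e≤ with ν , ν∈ ← strip-of-size m μ 0 parts z≤n = k ∸ e ∷ ν ,
  subst (λ w → (k ∸ e ∷ ν , w) ∈ below k (m ∷ μ ∷ʳ 0)) (trans (+-identityʳ _) (m∸[m∸n]≡n e≤k))
    (∈-below⁺ {μ = μ ∷ʳ 0} (subst (_≤ k ∸ e) (m∸[m∸n]≡n m≤k) (∸-monoʳ-≤ k e≤)) (m∸n≤m k e) ν∈)
... | no e≰ with ν , ν∈ ← strip-of-size m μ (e ∸ (k ∸ m)) parts
                 (m≤n+o⇒m∸n≤o e (k ∸ m) (≤-trans e≤k (≤-reflexive (sym (m∸n+n≡m m≤k))))) = m ∷ ν ,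
  subst (λ w → (m ∷ ν , w) ∈ below k (m ∷ μ ∷ʳ 0)) (m+[n∸m]≡n (<⇒≤ (≰⇒> e≰)))
    (∈-below⁺ {μ = μ ∷ʳ 0} ≤-refl m≤k ν∈)

below-at : ∀ k μ {ν w} → (ν , w) ∈ below k μ → ∀ i → at ν i ≤ at (k ∷ μ) i
below-at k []      (here refl) i = z≤n
below-at k (m ∷ μ) ν∈ i
  with j , j∈ , ν∈′ ← find (∈-concatMap⁻ (λ j → map (λ (ν , w) → j ∷ ν , k ∸ j + w) (below m μ)) {xs = range m k} ν∈)
  with (ν′ , w′) , ν′∈ , refl ← ∈-map⁻ (λ (ν , w) → j ∷ ν , k ∸ j + w) ν∈′ = go i
  where
  go : ∀ i → at (j ∷ ν′) i ≤ at (k ∷ m ∷ μ) i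
  go zero    = proj₂ (∈-range⁻ j∈)
  go (suc i) = below-at m μ ν′∈ i

last-zero : ∀ d μ → length μ ≡ suc d → at μ d ≡ 0 → ∃ λ μ′ → μ ≡ μ′ ∷ʳ 0
last-zero zero    (x ∷ [])    _  refl = [] , refl
last-zero (suc d) (x ∷ y ∷ μ) eq at≡0 with μ′ , μ≡ ← last-zero d (y ∷ μ) (suc-injective eq) at≡0 =
  x ∷ μ′ , cong (x ∷_) μ≡

Parts≤-++ˡ : ∀ k μ {ν} → Parts≤ k (μ ++ ν) → Parts≤ k μ
Parts≤-++ˡ k []      _       = tt
Parts≤-++ˡ k (m ∷ μ) (p , q) = p , Parts≤-++ˡ m μ q

-- Every step adds at most one part to μ, so for k ≤ c no part is ever forced into the strip.
strips-boxes : ∀ c k → k ≤ c → ∀ {β} → β ∈ boxes k →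
  ∃ λ μ → (μ , β) ∈ strips c k × (∀ i → k ≤ i → at μ i ≡ 0)
strips-boxes c zero    _   (here refl) = replicate c 0 , here refl , λ i _ → at-zeros c i
  where
  at-zeros : ∀ c i → at (replicate c 0) i ≡ 0
  at-zeros zero    i       = refl
  at-zeros (suc c) zero    = refl
  at-zeros (suc c) (suc i) = at-zeros c i
strips-boxes (suc c) (suc k) (s≤s k≤c) β∈
  with e , β′ , e∈ , β′∈ , refl ← ∈-cartesianProductWith⁻ _∷_ (upTo (suc k)) (boxes k) β∈
  with μ , μ∈ , vanish ← strips-boxes (suc c) k (m≤n⇒m≤1+n k≤c) β′∈
  with len , parts , _ ← strips-parts (suc c) k μ∈
  -- Here b ≤ c is used: `μ` has c + 1 parts, the last at index `c`, and it vanishes from index `k`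
  -- on, with k ≤ c.
  with μ′ , refl ← last-zero c μ len (vanish c k≤c)
  with ν , ν∈ ← strip-of-size k μ′ e (Parts≤-++ˡ k μ′ parts) (≤-pred (∈-upTo⁻ e∈)) =
  ν , ∈-concatMap⁺ _ (lose μ∈ (∈-map⁺ _ ν∈)) ,
  λ { (suc i) (s≤s k≤i) → n≤0⇒n≡0 (≤-trans (below-at k (μ′ ∷ʳ 0) ν∈ (suc i)) (≤-reflexive (vanish i k≤i))) }

below-nonempty : ∀ k μ → Parts≤ k μ → ∃ λ νw → νw ∈ below k μ
below-nonempty k []      _             = _ , here refl
below-nonempty k (m ∷ μ) (m≤k , parts) with _ , ν∈ ← below-nonempty m μ parts = _ , ∈-below⁺ {μ = μ} m≤k ≤-refl ν∈

schur-nonempty : ∀ K c κ → length κ ≡ c → Parts≤ K κ → ∃ λ σ → σ ∈ schur c κ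
schur-nonempty K zero    κ       _   _           = [] , here refl
schur-nonempty K (suc c) (k ∷ μ) len (_ , parts)
  with (ν , w) , ν∈ ← below-nonempty k μ parts
  with len′ , parts′ ← below-parts k μ parts ν∈
  with σ , σ∈ ← schur-nonempty k c ν (trans len′ (suc-injective len)) parts′ =
  σ ∷ʳ w , ∈-concatMap⁺ _ (lose ν∈ (∈-map⁺ _ σ∈))

-- Counting monomials of the product

++-injective : ∀ (as as′ : Exp) {bs bs′} → length as ≡ length as′ → as ++ bs ≡ as′ ++ bs′ → as ≡ as′ × bs ≡ bs′
++-injective []       []         _   eq = refl , eq
++-injective (a ∷ as) (a′ ∷ as′) len eq with refl , eq′ ← ∷-injective eq
  with refl , eq″ ← ++-injective as as′ (suc-injective len) eq′ = refl , eq″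

multiply-length : ∀ c b → b ≤ c → ∀ αs (ys : List Exp) zs → Unique ys → All (λ α → length α ≡ c) αs →
  (∀ {γ} → γ ∈ ys → γ ∈ αs) → (∀ {γ} → γ ∈ multiply c b αs → γ ∈ zs) → b ! * length ys ≤ length zs
multiply-length c b b≤c αs ys zs unique lens ys⊆ ⊆zs = subst (_≤ length zs)
  (trans (length-cartesianProductWith _,_ (boxes b) ys) (cong (_* length ys) (length-boxes b)))
  (length-≤-injection g (cartesianProduct (boxes b) ys) zs (cartesianProduct⁺ (boxes-unique b) unique)
    (λ x∈ → let β∈ , α∈ = ∈-cartesianProduct⁻ (boxes b) ys x∈
                μ , μ∈ , σ∈ = cofactor-∈ β∈
            in ⊆zs (∈-multiply⁺ c b αs (ys⊆ α∈) μ∈ σ∈))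
    λ x∈ x′∈ eq → injective (∈-cartesianProduct⁻ (boxes b) ys x∈) (∈-cartesianProduct⁻ (boxes b) ys x′∈) eq)
  where
  witness : ∀ {β} → β ∈ boxes b → ∃ λ σ → ∃ λ μ → (μ , β) ∈ strips c b × σ ∈ schur c μ
  witness β∈ with μ , μ∈ , _ ← strips-boxes c b b≤c β∈
    with len , parts , _ ← strips-parts c b μ∈
    with σ , σ∈ ← schur-nonempty b c μ len parts = σ , μ , μ∈ , σ∈

  -- The chosen σ has to depend on β alone and not on a membership proof, so that equal β have equal
  -- cofactors; the value `[]` outside `boxes b` is a mere default.
  cofactor : Exp → Exp
  cofactor β with β DecMem.∈? boxes b
  ... | yes β∈ = proj₁ (witness β∈)
  ... | no  _  = []

  cofactor-∈ : ∀ {β} → β ∈ boxes b → ∃ λ μ → (μ , β) ∈ strips c b × cofactor β ∈ schur c μ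
  cofactor-∈ {β} β∈ with β DecMem.∈? boxes b
  ... | yes β∈′ = proj₂ (witness β∈′)
  ... | no  β∉  = contradiction β∈ β∉

  g : Exp × Exp → Exp
  g (β , α) = α ⊞ cofactor β ++ β

  injective : ∀ {β α β′ α′} → β ∈ boxes b × α ∈ ys → β′ ∈ boxes b × α′ ∈ ys →
    g (β , α) ≡ g (β′ , α′) → (β , α) ≡ (β′ , α′)
  injective {β} {α} {β′} {α′} (β∈ , α∈) (β′∈ , α′∈) eq
    with μ , _ , σ∈ ← cofactor-∈ β∈ | μ′ , _ , σ′∈ ← cofactor-∈ β′∈
    with α≡ ← All.lookup lens (ys⊆ α∈) | α′≡ ← All.lookup lens (ys⊆ α′∈)
    with σ≡ ← length-schur c μ σ∈ | σ′≡ ← length-schur c μ′ σ′∈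
    -- Both left factors have length `c`, so cutting there recovers β; the cofactors then coincide
    -- and cancel.
    with eq₁ , refl ← ++-injective (α ⊞ cofactor β) (α′ ⊞ cofactor β′)
      (trans (trans (length-⊞ α _ (trans α≡ (sym σ≡))) α≡)
             (sym (trans (length-⊞ α′ _ (trans α′≡ (sym σ′≡))) α′≡))) eq =
    cong (β ,_) (⊞-cancelʳ α α′ (cofactor β) (trans α≡ (sym σ≡)) (trans α′≡ (sym σ≡)) eq₁)

theorem3p1 : (bs : List ℕ) (b : ℕ) → All (λ x → 1 ≤ x) bs → 1 ≤ b →
    2 * b ≤ sum bs + b →
    b ! * length (supp (schubert (layered bs))) ≤ length (supp (schubert (layered (bs ++ [ b ]))))
theorem3p1 bs b _ _ 2b≤ with αs , sumOf , lens ← schubert-positive (reverseView bs) =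
  multiply-length (sum bs) b b≤ αs (supp (schubert (layered bs))) _
    (deduplicate-! _) lens (∈-supp⁻ (schubert (layered bs)) αs sumOf)
    (∈-supp⁺ (schubert (layered (bs ++ [ b ]))) _ (schubert-∷ʳ bs b αs sumOf))
  where
  -- As n is `sum bs + b`, the bound b ≤ n/2 amounts to b ≤ c.
  b≤ : b ≤ sum bs
  b≤ = +-cancelʳ-≤ b b (sum bs) (subst (_≤ sum bs + b) (cong (b +_) (+-identityʳ b)) 2b≤)
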